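{- Let $G$ be a biconnected 4-planar graph with positive flexibility, having a valid orthogonal representation. Then $G$ has a valid orthogonal representation with the same planar embedding, the same angles around vertices and at most three bends per edge, except for at most one edge on the outer face with up to five bends.
   Context: A 4-planar graph is a planar graph of maximum degree at most $4$. An orthogonal representation $\mathcal R$ of a biconnected 4-planar graph $G$ consists of a planar embedding of $G$ (with a designated outer face) together with integers $\mathrm{rot}(e_f)$ and $\mathrm{rot}(v_f)\in\{ -1,0,1\}$ for every incidence of an edge $e$, respectively a vertex $v$, with a face $f$, such that: (I) if $e$ is incident to the faces $f_1,f_2$, then $\mathrm{rot}(e_{f_1})=-\mathrm{rot}(e_{f_2})$; (II) the sum of all rotations of edges and vertices in a face is $4$ for every inner face and $-4$ for the outer face; (III) the sum of the rotations around every vertex $v$ is $2(\deg(v)-2)$. Meaning: traversing $f$ with $f$ on the right (clockwise for inner faces, counter-clockwise for the outer face), $\mathrm{rot}(e_f)$ is the number of right bends minus the number of left bends of $e$, and $\mathrm{rot}(v_f)=1,0,-1$ for a right turn, no turn, left turn at $v$ (angle $90^\circ,180^\circ,270^\circ$ of $v$ in $f$). The number of bends of $e$ is $|\mathrm{rot}(e_f)|$. Every edge $e$ has a flexibility $\mathrm{flex}(e)\in\mathbb N_0\cup\{\infty\}$. $G$ has positive flexibility if $\mathrm{flex}(e)\ge 1$ for every edge $e$. An orthogonal representation is valid if every edge $e$ has at most $\mathrm{flex}(e)$ bends. "The same planar embedding" (including the outer face) and "the same angles around vertices" (all values $\mathrm{rot}(v_f)$) refer to the given valid orthogonal representation. 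-}

module Defs where

open import Data.Bool.Base using (Bool; true; false; not)
open import Data.Fin.Base using (Fin)
import Data.Fin.Properties as Fin
open import Data.Integer.Base as ℤ using (ℤ; +_; -[1+_]; 0ℤ; 1ℤ; -1ℤ)
open import Data.List.Base
  using (List; []; _∷_; map; foldr; filter; length; allFin; cartesianProduct)
open import Data.Nat.Base as ℕ using (ℕ)
open import Data.Product.Base using (_×_; _,_; proj₁; ∃; ∃-syntax)
open import Data.Sum.Base using (_⊎_)
open import Function.Bundles using (_↔_; _⇔_; Inverse)
open import Function.Definitions using (Surjective)
open import Relation.Binary.Construct.Add.Supremum.NonStrict ℕ._≤_ using (_≤⁺_)
open import Relation.Binary.Construct.Closure.ReflexiveTransitive using (Star)
open import Relation.Binary.PropositionalEquality.Core using (_≡_; _≢_)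
open import Relation.Nullary.Construct.Add.Supremum using (_⁺; [_])

-- Every edge is a pair of opposite darts; the direction in which an edge is
-- stored has no significance.
Dart : ℕ → Set
Dart numEdges = Fin numEdges × Bool

rev : ∀ {m} → Dart m → Dart m
rev (e , b) = e , not b

edgeOf : ∀ {m} → Dart m → Fin m
edgeOf = proj₁

allDarts : ∀ m → List (Dart m)
allDarts m = cartesianProduct (allFin m) (true ∷ false ∷ [])

-- Finite simple undirected graphs.
record Graph : Set where
  field
    numVertices : ℕ
    numEdges    : ℕ
    tail        : Dart numEdges → Fin numVertices

  head : Dart numEdges → Fin numVertices
  head d = tail (rev d)

  field
    loopless    : ∀ d → tail d ≢ head d
    no-parallel : ∀ d d′ → tail d ≡ tail d′ → head d ≡ head d′ → edgeOf d ≡ edgeOf d′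

  Vertex : Set
  Vertex = Fin numVertices

  Edge : Set
  Edge = Fin numEdges

  darts : List (Dart numEdges)
  darts = allDarts numEdges

  dartsAt : Vertex → List (Dart numEdges)
  dartsAt v = filter (λ d → tail d Fin.≟ v) darts

  degree : Vertex → ℕ
  degree v = length (dartsAt v)

  Adjacent : Vertex → Vertex → Set
  Adjacent u v = ∃[ d ] (tail d ≡ u × head d ≡ v)

  AdjacentAvoiding : Vertex → Vertex → Vertex → Set
  AdjacentAvoiding x u v = Adjacent u v × u ≢ x × v ≢ x

MaxDegree≤ : ℕ → Graph → Set
MaxDegree≤ k G = ∀ v → degree v ℕ.≤ k
  where open Graph G

Connected : Graph → Set
Connected G = ∀ u v → Star Adjacent u v
  where open Graph G

NoCutvertex : Graph → Set
NoCutvertex G = ∀ x u v → u ≢ x → v ≢ x → Star (AdjacentAvoiding x) u v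
  where open Graph G

Biconnected : Graph → Set
Biconnected G = Connected G × NoCutvertex G

-- Reachability under the iterates of f.
Orbit : {A : Set} → (A → A) → A → A → Set
Orbit f = Star (λ x y → f x ≡ y)

-- A combinatorial planar embedding of a connected graph with at least one edge:
-- the cyclic order of the edges around each vertex, together with the choice of
-- an outer face.  The system of cyclic orders comes from a drawing in the plane
-- iff it satisfies Euler's formula.
record PlanarEmbedding (G : Graph) : Set where
  open Graph G
  field
    -- The counter-clockwise successor of a dart among the darts leaving its tail.
    ccw        : Dart numEdges ↔ Dart numEdges
    ccw-cyclic : ∀ d d′ → tail d ≡ tail d′ ⇔ Orbit (Inverse.to ccw) d d′

  -- The next dart in the traversal that keeps the face on the right.
  nextOnFace : Dart numEdges → Dart numEdges
  nextOnFace d = Inverse.to ccw (rev d)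

  field
    numFaces     : ℕ
    -- The face to the right of a dart.
    face         : Dart numEdges → Fin numFaces
    face-orbit   : ∀ d d′ → face d ≡ face d′ ⇔ Orbit nextOnFace d d′
    face-nonvoid : Surjective _≡_ _≡_ face
    euler        : numVertices ℕ.+ numFaces ≡ numEdges ℕ.+ 2
    outerFace    : Fin numFaces

  Face : Set
  Face = Fin numFaces

  dartsOn : Face → List (Dart numEdges)
  dartsOn f = filter (λ d → face d Fin.≟ f) darts

  OnOuterFace : Edge → Set
  OnOuterFace e = ∃[ b ] face (e , b) ≡ outerFace

sumOver : {A : Set} → List A → (A → ℤ) → ℤ
sumOver xs w = foldr ℤ._+_ 0ℤ (map w xs)

-- Incidences with faces are indexed by darts.  A dart d stands for the incidence
-- of its edge with face d, and also for the incidence of tail d with face d at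
-- the corner where the traversal of face d leaves tail d along d.  In a
-- biconnected graph with at least three vertices these are in bijection with
-- the incident edge-face and vertex-face pairs.
record OrthogonalRepresentation {G : Graph} (ℰ : PlanarEmbedding G) : Set where
  open Graph G
  open PlanarEmbedding ℰ
  field
    rotE : Dart numEdges → ℤ
    rotV : Dart numEdges → ℤ
    rotV-values : ∀ d → rotV d ≡ -1ℤ ⊎ rotV d ≡ 0ℤ ⊎ rotV d ≡ 1ℤ

  faceRotation : Face → ℤ
  faceRotation f = sumOver (dartsOn f) rotE ℤ.+ sumOver (dartsOn f) rotV

  field
    edge-antisym : ∀ d → rotE d ≡ ℤ.- rotE (rev d)
    inner-face   : ∀ f → f ≢ outerFace → faceRotation f ≡ + 4
    outer-face   : faceRotation outerFace ≡ ℤ.- (+ 4)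
    vertex-sum   : ∀ v → sumOver (dartsAt v) rotV ≡ + 2 ℤ.* (+ degree v ℤ.- + 2)

  -- By edge-antisym the choice of side is immaterial.
  bends : Edge → ℕ
  bends e = ℤ.∣ rotE (e , true) ∣

-- ℕ ⁺ is ℕ with a greatest element ∞ adjoined.
Flexibility : Graph → Set
Flexibility G = Graph.Edge G → ℕ ⁺

PositiveFlexibility : (G : Graph) → Flexibility G → Set
PositiveFlexibility G flex = ∀ e → [ 1 ] ≤⁺ flex e

module _ {G : Graph} {ℰ : PlanarEmbedding G} where
  open Graph G
  open PlanarEmbedding ℰ
  open OrthogonalRepresentation

  Valid : Flexibility G → OrthogonalRepresentation ℰ → Set
  Valid flex R = ∀ e → [ bends R e ] ≤⁺ flex e

  SameAngles : OrthogonalRepresentation ℰ → OrthogonalRepresentation ℰ → Set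
  SameAngles R R′ = ∀ d → rotV R d ≡ rotV R′ d

  AtMostThreeBendsExceptOne : OrthogonalRepresentation ℰ → Set
  AtMostThreeBendsExceptOne R =
      (∀ e → bends R e ℕ.≤ 3)
    ⊎ ∃[ e₀ ] ( OnOuterFace e₀
              × bends R e₀ ℕ.≤ 5
              × (∀ e → e ≢ e₀ → bends R e ℕ.≤ 3) )

{-# OPTIONS --safe #-}
module Submission where

open import Defs
open import Data.Bool.Base using (true; false; not)
import Data.Bool.Properties as Bool
open import Data.Empty using (⊥; ⊥-elim)
open import Data.Fin.Base using (Fin)
import Data.Fin.Properties as Fin
open import Data.Integer.Base as ℤ
  using (ℤ; +_; -[1+_]; 0ℤ; 1ℤ; -1ℤ; _+_; _*_; _-_; -_; _≤_; ∣_∣)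
import Data.Integer.Properties as ℤ
open import Data.Integer.Tactic.RingSolver using (solve-∀)
open import Data.List.Base
  using (List; []; _∷_; _++_; map; filter; length; allFin; cartesianProduct)
import Data.List.Membership.DecPropositional as DecMembership
open import Data.List.Membership.Propositional using (_∈_; _∉_)
open import Data.List.Membership.Propositional.Properties
  using (∈-allFin; ∈-cartesianProduct⁺; ∈-map⁻; ∈-++⁺ˡ; ∈-++⁺ʳ; ∈-++⁻; ∈-∃++; ∈-filter⁺; ∈-filter⁻)
import Data.List.Properties as List
open import Data.List.Relation.Binary.Subset.Propositional using (_⊆_)
open import Data.List.Relation.Unary.All as All using (All; []; _∷_)
open import Data.List.Relation.Unary.AllPairs using ([]; _∷_)
open import Data.List.Relation.Unary.Any as Any using (here; there)
open import Data.List.Relation.Unary.Unique.Propositional using (Unique)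
import Data.List.Relation.Unary.Unique.Propositional.Properties as Unique
open import Data.Nat.Base as ℕ using (ℕ; zero; suc; s≤s; z≤n)
open import Data.Nat.Induction using (<-wellFounded)
open import Data.Nat.ListAction using (sum)
import Data.Nat.Properties as ℕ
open import Data.Product.Base using (Σ-syntax; _×_; _,_; proj₁; proj₂; ∃; ∃-syntax; swap)
import Data.Product.Properties as Product
open import Data.Sum.Base using (_⊎_; inj₁; inj₂; [_,_]′)
open import Function.Bundles using (Inverse; Equivalence)
open import Induction.WellFounded using (Acc; acc)
open import Relation.Binary.Construct.Add.Supremum.NonStrict ℕ._≤_ using ([_]; ≤⁺-trans)
open import Relation.Binary.Construct.Closure.ReflexiveTransitive using (Star; ε; _◅_)
open import Relation.Binary.Definitions using (DecidableEquality)
open import Relation.Binary.PropositionalEquality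
open import Relation.Nullary using (¬_; Dec; yes; no; contradiction)
open import Relation.Nullary.Decidable using (_×-dec_; _⊎-dec_; ¬?; map′)

-- Let a dart d₀ have rotation at least 4, and let S be the set of faces reachable
-- from its face by crossing darts of rotation at most 0 from right to left.  If S
-- contains the face on the other side of d₀, then lowering d₀ by one and raising
-- the darts of the path by one keeps all face sums and spends a bend only on edges
-- that had none; the excess of bends over one per edge drops.  Otherwise every
-- dart leaving S has rotation at least 1.  Summing the face conditions over S and
-- using that the closure of S, being connected through faces and not the whole
-- sphere, has Euler characteristic at most 1, one finds that S avoids the outer
-- face and that the rotations of the darts leaving S exceed 1 by at most 4 in
-- total.  With biconnectivity and Euler's formula, the complement of S is then the
-- outer face alone, and d₀ is the only dart of rotation at least 4 bounding it.

-- Indicators and sums over lists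

private
  variable
    A B : Set

-- Reduces one linear inequality to another by an identity between the two differences, which the
-- ring solver can check.
≤-by-difference : ∀ {i j k l} → j - i ≡ l - k → i ≤ j → k ≤ l
≤-by-difference eq i≤j = ℤ.0≤i-j⇒j≤i (subst (0ℤ ≤_) eq (ℤ.i≤j⇒0≤j-i i≤j))

⟦_⟧ : {P : Set} → Dec P → ℤ
⟦ yes _ ⟧ = 1ℤ
⟦ no  _ ⟧ = 0ℤ

⟦⟧-yes : {P : Set} (P? : Dec P) → P → ⟦ P? ⟧ ≡ 1ℤ
⟦⟧-yes (yes _) _ = refl
⟦⟧-yes (no ¬p) p = contradiction p ¬p

⟦⟧-no : {P : Set} (P? : Dec P) → ¬ P → ⟦ P? ⟧ ≡ 0ℤ
⟦⟧-no (yes p) ¬p = contradiction p ¬p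
⟦⟧-no (no _)  _  = refl

⟦⟧-cong : {P Q : Set} (P? : Dec P) (Q? : Dec Q) → (P → Q) → (Q → P) → ⟦ P? ⟧ ≡ ⟦ Q? ⟧
⟦⟧-cong (yes p) Q? f g = sym (⟦⟧-yes Q? (f p))
⟦⟧-cong (no ¬p) Q? f g = sym (⟦⟧-no Q? (λ q → ¬p (g q)))

⟦⟧-⊎ : {P Q R : Set} (P? : Dec P) (Q? : Dec Q) (R? : Dec R) →
       (P → ¬ Q) → (P ⊎ Q → R) → (R → P ⊎ Q) → ⟦ P? ⟧ + ⟦ Q? ⟧ ≡ ⟦ R? ⟧
⟦⟧-⊎ (yes p) Q? R? disj f g =
  trans (cong (_+_ 1ℤ) (⟦⟧-no Q? (disj p))) (sym (⟦⟧-yes R? (f (inj₁ p))))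
⟦⟧-⊎ (no ¬p) Q? R? disj f g =
  trans (ℤ.+-identityˡ _)
        (⟦⟧-cong Q? R? (λ q → f (inj₂ q)) (λ r → [ (λ p → contradiction p ¬p) , (λ q → q) ]′ (g r)))

0≤⟦⟧ : {P : Set} (P? : Dec P) → 0ℤ ≤ ⟦ P? ⟧
0≤⟦⟧ (yes _) = ℤ.+≤+ z≤n
0≤⟦⟧ (no  _) = ℤ.+≤+ z≤n

sumOver-cong : (xs : List A) {w w′ : A → ℤ} → (∀ x → w x ≡ w′ x) → sumOver xs w ≡ sumOver xs w′
sumOver-cong []       eq = refl
sumOver-cong (x ∷ xs) eq = cong₂ _+_ (eq x) (sumOver-cong xs eq)

sumOver-mono : (xs : List A) {w w′ : A → ℤ} → (∀ x → w x ≤ w′ x) → sumOver xs w ≤ sumOver xs w′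
sumOver-mono []       le = ℤ.≤-refl
sumOver-mono (x ∷ xs) le = ℤ.+-mono-≤ (le x) (sumOver-mono xs le)

sumOver-0 : (xs : List A) → sumOver xs (λ _ → 0ℤ) ≡ 0ℤ
sumOver-0 []       = refl
sumOver-0 (x ∷ xs) = trans (ℤ.+-identityˡ _) (sumOver-0 xs)

interchange : ∀ a b c d → (a + b) + (c + d) ≡ (a + c) + (b + d)
interchange = solve-∀

sumOver-+ : (xs : List A) (w w′ : A → ℤ) →
            sumOver xs (λ x → w x + w′ x) ≡ sumOver xs w + sumOver xs w′
sumOver-+ []       w w′ = refl
sumOver-+ (x ∷ xs) w w′ =
  trans (cong (_+_ (w x + w′ x)) (sumOver-+ xs w w′)) (interchange (w x) (w′ x) _ _)

sumOver-*ˡ : (xs : List A) (k : ℤ) (w : A → ℤ) → sumOver xs (λ x → k * w x) ≡ k * sumOver xs w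
sumOver-*ˡ []       k w = sym (ℤ.*-zeroʳ k)
sumOver-*ˡ (x ∷ xs) k w =
  trans (cong (_+_ (k * w x)) (sumOver-*ˡ xs k w)) (sym (ℤ.*-distribˡ-+ k (w x) _))

sumOver-*ʳ : (xs : List A) (w : A → ℤ) (k : ℤ) → sumOver xs (λ x → w x * k) ≡ sumOver xs w * k
sumOver-*ʳ []       w k = refl
sumOver-*ʳ (x ∷ xs) w k =
  trans (cong (_+_ (w x * k)) (sumOver-*ʳ xs w k)) (sym (ℤ.*-distribʳ-+ k (w x) _))

sumOver-neg : (xs : List A) (w : A → ℤ) → sumOver xs (λ x → - w x) ≡ - sumOver xs w
sumOver-neg []       w = refl
sumOver-neg (x ∷ xs) w =
  trans (cong (_+_ (- w x)) (sumOver-neg xs w)) (sym (ℤ.neg-distrib-+ (w x) _))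

sumOver-- : (xs : List A) (w w′ : A → ℤ) →
            sumOver xs (λ x → w x - w′ x) ≡ sumOver xs w - sumOver xs w′
sumOver-- xs w w′ = trans (sumOver-+ xs w (λ x → - w′ x)) (cong (_+_ (sumOver xs w)) (sumOver-neg xs w′))

sumOver-const : (xs : List A) (k : ℤ) → sumOver xs (λ _ → k) ≡ k * + length xs
sumOver-const []       k = sym (ℤ.*-zeroʳ k)
sumOver-const (x ∷ xs) k = trans (cong (_+_ k) (sumOver-const xs k)) (sym (ℤ.*-suc k (+ length xs)))

sumOver-swap : (xs : List A) (ys : List B) (w : A → B → ℤ) →
               sumOver xs (λ x → sumOver ys (w x)) ≡ sumOver ys (λ y → sumOver xs (λ x → w x y))
sumOver-swap []       ys w = sym (sumOver-0 ys)
sumOver-swap (x ∷ xs) ys w =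
  trans (cong (_+_ (sumOver ys (w x))) (sumOver-swap xs ys w))
        (sym (sumOver-+ ys (w x) (λ y → sumOver xs (λ x → w x y))))

sumOver-map : (f : A → B) (xs : List A) (w : B → ℤ) → sumOver (map f xs) w ≡ sumOver xs (λ x → w (f x))
sumOver-map f []       w = refl
sumOver-map f (x ∷ xs) w = cong (_+_ (w (f x))) (sumOver-map f xs w)

sumOver-filter : {P : A → Set} (P? : ∀ x → Dec (P x)) (xs : List A) (w : A → ℤ) →
                 sumOver (filter P? xs) w ≡ sumOver xs (λ x → ⟦ P? x ⟧ * w x)
sumOver-filter P? []       w = refl
sumOver-filter P? (x ∷ xs) w with P? x
... | yes _ = cong₂ _+_ (sym (ℤ.*-identityˡ (w x))) (sumOver-filter P? xs w)
... | no  _ = trans (sumOver-filter P? xs w) (sym (ℤ.+-identityˡ _))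

swap-front : ∀ a b c → a + (b + c) ≡ b + (a + c)
swap-front = solve-∀

sumOver-extract : (xs : List A) {x : A} {ys : List A} (w : A → ℤ) →
                  sumOver (xs ++ x ∷ ys) w ≡ w x + sumOver (xs ++ ys) w
sumOver-extract []       w = refl
sumOver-extract (y ∷ xs) {x} w = trans (cong (_+_ (w y)) (sumOver-extract xs w)) (swap-front (w y) (w x) _)

sumOver-nonneg : (xs : List A) {w : A → ℤ} → (∀ x → 0ℤ ≤ w x) → 0ℤ ≤ sumOver xs w
sumOver-nonneg []       nn = ℤ.≤-refl
sumOver-nonneg (x ∷ xs) nn = ℤ.+-mono-≤ (nn x) (sumOver-nonneg xs nn)

-- Each entry of `xs` in turn is cut out of `ys`; uniqueness ensures that the later entries survive
-- the cut, and what is left over at the end is nonnegative.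
sumOver-⊆ : {xs ys : List A} {w : A → ℤ} → (∀ x → 0ℤ ≤ w x) →
            Unique xs → xs ⊆ ys → sumOver xs w ≤ sumOver ys w
sumOver-⊆ {ys = ys} nn [] _ = sumOver-nonneg ys nn
sumOver-⊆ {xs = x ∷ xs} {w = w} nn (x∉ ∷ uniq) sub with ∈-∃++ (sub (here refl))
... | as , bs , refl =
  ℤ.≤-trans (ℤ.+-monoʳ-≤ (w x) (sumOver-⊆ nn uniq rest)) (ℤ.≤-reflexive (sym (sumOver-extract as w)))
  where
  rest : xs ⊆ as ++ bs
  rest y∈ with ∈-++⁻ as (sub (there y∈))
  ... | inj₁ y∈as         = ∈-++⁺ˡ y∈as
  ... | inj₂ (here refl)  = contradiction refl (All.lookup x∉ y∈)
  ... | inj₂ (there y∈bs) = ∈-++⁺ʳ as y∈bs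

length-⊆ : {xs ys : List A} → Unique xs → xs ⊆ ys → length xs ℕ.≤ length ys
length-⊆ {xs = xs} {ys} uniq sub = ℤ.drop‿+≤+ (subst₂ _≤_ (count xs) (count ys)
  (sumOver-⊆ {w = λ _ → 1ℤ} (λ _ → ℤ.+≤+ z≤n) uniq sub))
  where
  count : ∀ zs → sumOver zs (λ _ → 1ℤ) ≡ + length zs
  count zs = trans (sumOver-const zs 1ℤ) (ℤ.*-identityˡ _)

length-allFin : ∀ n → length (allFin n) ≡ n
length-allFin n = List.length-tabulate (λ i → i)

length-Fin : ∀ {n} {xs : List (Fin n)} → Unique xs → length xs ℕ.≤ n
length-Fin {n} {xs} uniq =
  subst (length xs ℕ.≤_) (length-allFin n) (length-⊆ uniq (λ {x} _ → ∈-allFin x))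

∉⇒All≢ : {x : A} {xs : List A} → x ∉ xs → All (x ≢_) xs
∉⇒All≢ x∉ = All.tabulate (λ y∈ eq → x∉ (subst (_∈ _) (sym eq) y∈))

module _ (_≟_ : DecidableEquality A) where
  open DecMembership _≟_ using (_∈?_)

  sumOver-indicator : (x : A) {ys : List A} → Unique ys → sumOver ys (λ y → ⟦ x ≟ y ⟧) ≡ ⟦ x ∈? ys ⟧
  sumOver-indicator x {[]}     []            = refl
  sumOver-indicator x {y ∷ ys} (y∉ ∷ uniq) =
    trans (cong (_+_ ⟦ x ≟ y ⟧) (sumOver-indicator x uniq))
          (⟦⟧-⊎ (x ≟ y) (x ∈? ys) (x ∈? (y ∷ ys))
                (λ x≡y x∈ → All.lookup y∉ x∈ (sym x≡y)) [ here , there ]′ Any.toSum)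

  -- Double counting: with `face` or `tail` for `φ`, it turns sums over a set of faces or vertices
  -- into sums over all darts, where terms of both kinds can be compared dart by dart.
  sumOver-fibres : (φ : B → A) (xs : List B) {ys : List A} (w : B → ℤ) → Unique ys →
                   sumOver ys (λ y → sumOver (filter (λ x → φ x ≟ y) xs) w)
                     ≡ sumOver xs (λ x → ⟦ φ x ∈? ys ⟧ * w x)
  sumOver-fibres φ xs {ys} w uniq = begin
    sumOver ys (λ y → sumOver (filter (λ x → φ x ≟ y) xs) w)
      ≡⟨ sumOver-cong ys (λ y → sumOver-filter (λ x → φ x ≟ y) xs w) ⟩
    sumOver ys (λ y → sumOver xs (λ x → ⟦ φ x ≟ y ⟧ * w x))
      ≡⟨ sumOver-swap ys xs (λ y x → ⟦ φ x ≟ y ⟧ * w x) ⟩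
    sumOver xs (λ x → sumOver ys (λ y → ⟦ φ x ≟ y ⟧ * w x))
      ≡⟨ sumOver-cong xs (λ x → sumOver-*ʳ ys (λ y → ⟦ φ x ≟ y ⟧) (w x)) ⟩
    sumOver xs (λ x → sumOver ys (λ y → ⟦ φ x ≟ y ⟧) * w x)
      ≡⟨ sumOver-cong xs (λ x → cong (_* w x) (sumOver-indicator (φ x) uniq)) ⟩
    sumOver xs (λ x → ⟦ φ x ∈? ys ⟧ * w x) ∎
    where open ≡-Reasoning

-- Darts and their edges

_≟ᵈ_ : ∀ {m} → DecidableEquality (Dart m)
_≟ᵈ_ = Product.≡-dec Fin._≟_ Bool._≟_

rev-involutive : ∀ {m} (d : Dart m) → rev (rev d) ≡ d
rev-involutive (e , b) = cong (e ,_) (Bool.not-involutive b)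

rev-injective : ∀ {m} {d d′ : Dart m} → rev d ≡ rev d′ → d ≡ d′
rev-injective {d = d} {d′} eq = trans (sym (rev-involutive d)) (trans (cong rev eq) (rev-involutive d′))

rev-≢ : ∀ {m} (d : Dart m) → rev d ≢ d
rev-≢ (e , true)  ()
rev-≢ (e , false) ()

same-edge : ∀ {m} (d d′ : Dart m) → edgeOf d ≡ edgeOf d′ → d ≡ d′ ⊎ d ≡ rev d′
same-edge (e , true)  (.e , true)  refl = inj₁ refl
same-edge (e , true)  (.e , false) refl = inj₂ refl
same-edge (e , false) (.e , true)  refl = inj₂ refl
same-edge (e , false) (.e , false) refl = inj₁ refl

∈-allDarts : ∀ {m} (d : Dart m) → d ∈ allDarts m
∈-allDarts (e , true)  = ∈-cartesianProduct⁺ (∈-allFin e) (here refl)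
∈-allDarts (e , false) = ∈-cartesianProduct⁺ (∈-allFin e) (there (here refl))

allDarts-unique : ∀ m → Unique (allDarts m)
allDarts-unique m =
  Unique.cartesianProduct⁺ (Unique.allFin⁺ m) (((λ ()) ∷ []) ∷ [] ∷ [])

any-dart? : ∀ {m} {Q : Dart m → Set} → (∀ d → Dec (Q d)) → Dec (∃ Q)
any-dart? Q? = map′
  (λ { (e , inj₁ q) → (e , true) , q ; (e , inj₂ q) → (e , false) , q })
  (λ { ((e , true) , q) → e , inj₁ q ; ((e , false) , q) → e , inj₂ q })
  (Fin.any? (λ e → Q? (e , true) ⊎-dec Q? (e , false)))

sumOver-allDarts : ∀ m (w : Dart m → ℤ) →
                   sumOver (allDarts m) w ≡ sumOver (allFin m) (λ e → w (e , true) + w (e , false))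
sumOver-allDarts m w = go (allFin m)
  where
  go : ∀ es → sumOver (cartesianProduct es (true ∷ false ∷ [])) w
              ≡ sumOver es (λ e → w (e , true) + w (e , false))
  go []       = refl
  go (e ∷ es) =
    trans (sym (ℤ.+-assoc (w (e , true)) (w (e , false)) _))
          (cong (_+_ (w (e , true) + w (e , false))) (go es))

sumOver-antisym : ∀ m (w : Dart m → ℤ) → (∀ d → w d ≡ - w (rev d)) → sumOver (allDarts m) w ≡ 0ℤ
sumOver-antisym m w anti = begin
  sumOver (allDarts m) w                                   ≡⟨ sumOver-allDarts m w ⟩
  sumOver (allFin m) (λ e → w (e , true) + w (e , false))
    ≡⟨ sumOver-cong (allFin m) (λ e →
         trans (cong (_+ w (e , false)) (anti (e , true))) (ℤ.+-inverseˡ (w (e , false)))) ⟩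
  sumOver (allFin m) (λ _ → 0ℤ)                            ≡⟨ sumOver-0 (allFin m) ⟩
  0ℤ ∎
  where open ≡-Reasoning

-- Search trees in the graph on Fin n whose edges are the darts satisfying P,
-- a dart d leading from end d to end (rev d).  The indices list the nodes and
-- the darts of the tree, latest first.

module _ {n m : ℕ} (end : Dart m → Fin n) (P : Dart m → Set) (r : Fin n) where

  data Tree : List (Fin n) → List (Dart m) → Set where
    root : Tree (r ∷ []) []
    grow : ∀ {xs ds} d → Tree xs ds → P d → end d ∈ xs → end (rev d) ∉ xs →
           Tree (end (rev d) ∷ xs) (d ∷ ds)

module _ {n m : ℕ} {end : Dart m → Fin n} {P : Dart m → Set} {r : Fin n} where

  tree-unique : ∀ {xs ds} → Tree end P r xs ds → Unique xs
  tree-unique root                = [] ∷ []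
  tree-unique (grow d t _ _ new) = ∉⇒All≢ new ∷ tree-unique t

  tree-length : ∀ {xs ds} → Tree end P r xs ds → length xs ≡ suc (length ds)
  tree-length root               = refl
  tree-length (grow d t _ _ _) = cong suc (tree-length t)

  root∈tree : ∀ {xs ds} → Tree end P r xs ds → r ∈ xs
  root∈tree root               = here refl
  root∈tree (grow d t _ _ _) = there (root∈tree t)

  tree-ends : ∀ {xs ds} → Tree end P r xs ds → ∀ {d} → d ∈ ds → P d × end d ∈ xs × end (rev d) ∈ xs
  tree-ends (grow d t p d∈ _) (here refl) = p , there d∈ , here refl
  tree-ends (grow d t _ _ _)  (there d′∈) with tree-ends t d′∈
  ... | p , a , b = p , there a , there b

  tree-edge-end : ∀ {xs ds} → Tree end P r xs ds → ∀ d → edgeOf d ∈ map edgeOf ds → end d ∈ xs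
  tree-edge-end t d e∈ with ∈-map⁻ edgeOf e∈
  ... | d′ , d′∈ , eq with same-edge d d′ eq | tree-ends t d′∈
  ... | inj₁ refl | _ , a , _ = a
  ... | inj₂ refl | _ , _ , b = b

  -- The latest edge has an end that is new, while all earlier edges have both ends among the
  -- earlier nodes.
  tree-edges-unique : ∀ {xs ds} → Tree end P r xs ds → Unique (map edgeOf ds)
  tree-edges-unique root               = []
  tree-edges-unique (grow d t _ _ new) =
    ∉⇒All≢ (λ e∈ → new (tree-edge-end t (rev d) e∈)) ∷ tree-edges-unique t

  record ClosedTree : Set where
    field
      {nodes}     : List (Fin n)
      {treeDarts} : List (Dart m)
      tree        : Tree end P r nodes treeDarts
      closed      : ∀ d → P d → end d ∈ nodes → end (rev d) ∈ nodes

  open DecMembership (Fin._≟_ {n}) using (_∈?_)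

  search : (∀ d → Dec (P d)) → ClosedTree
  search P? = go n root (ℕ.n≤1+n n)
    where
    -- The fuel `k` bounds the number of missing nodes. Once it is used up, growing again would give
    -- more than `n` distinct nodes.
    go : ∀ k {xs ds} → Tree end P r xs ds → n ℕ.≤ length xs ℕ.+ k → ClosedTree
    go k {xs} t n≤ with any-dart? (λ d → P? d ×-dec (end d ∈? xs) ×-dec ¬? (end (rev d) ∈? xs))
    go k       {xs} t n≤ | no stuck = record { tree = t ; closed = closed }
      where
      closed : ∀ d → P d → end d ∈ xs → end (rev d) ∈ xs
      closed d p d∈ with end (rev d) ∈? xs
      ... | yes d∈′ = d∈′
      ... | no  d∉  = contradiction (d , p , d∈ , d∉) stuck
    go zero    t n≤ | yes (d , p , d∈ , d∉) = contradiction
      (ℕ.≤-trans (length-Fin (tree-unique (grow d t p d∈ d∉))) (subst (n ℕ.≤_) (ℕ.+-identityʳ _) n≤))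
      ℕ.1+n≰n
    go (suc k) {xs} t n≤ | yes (d , p , d∈ , d∉) =
      go k (grow d t p d∈ d∉) (subst (n ℕ.≤_) (ℕ.+-suc (length xs) k) n≤)

module _ {n : ℕ} where
  open DecMembership (Fin._≟_ {n}) public using (_∈?_)

-- Traversing faces

module _ {G : Graph} (ℰ : PlanarEmbedding G) where
  open Graph G
  open PlanarEmbedding ℰ

  tail-ccw : ∀ d → tail (Inverse.to ccw d) ≡ tail d
  tail-ccw d = sym (Equivalence.from (ccw-cyclic d _) (refl ◅ ε))

  tail-next : ∀ d → tail (nextOnFace d) ≡ head d
  tail-next d = tail-ccw (rev d)

  face-next : ∀ d → face (nextOnFace d) ≡ face d
  face-next d = sym (Equivalence.from (face-orbit d _) (refl ◅ ε))

  -- `Inverse.to ccw d` follows `rev d` on the face to the left of `d`.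
  face-ccw : ∀ d → face (Inverse.to ccw d) ≡ face (rev d)
  face-ccw d = subst (λ d′ → face (Inverse.to ccw d′) ≡ face (rev d)) (rev-involutive d) (face-next (rev d))

  Touches : List Face → Dart numEdges → Set
  Touches S d = face d ∈ S ⊎ face (rev d) ∈ S

  touches? : ∀ S d → Dec (Touches S d)
  touches? S d = (face d ∈? S) ⊎-dec (face (rev d) ∈? S)

  touches-rev : ∀ {S d} → Touches S d → Touches S (rev d)
  touches-rev {S} {d} (inj₁ f∈) = inj₂ (subst (λ d′ → face d′ ∈ S) (sym (rev-involutive d)) f∈)
  touches-rev (inj₂ f∈) = inj₁ f∈

  touches-edge : ∀ {S d} → Touches S d → Touches S (edgeOf d , true)
  touches-edge {d = e , true}  t = t
  touches-edge {d = e , false} t = touches-rev t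

  touchedEdges : List Face → List Edge
  touchedEdges S = filter (λ e → touches? S (e , true)) (allFin numEdges)

  ∈-touchedEdges : ∀ {S} d → Touches S d → edgeOf d ∈ touchedEdges S
  ∈-touchedEdges {S} d t = ∈-filter⁺ (λ e → touches? S (e , true)) (∈-allFin (edgeOf d)) (touches-edge t)

  module _ (In : Vertex → Set) where

    Balanced : Dart numEdges → Set
    Balanced d = (In (tail d) → In (head d)) × (In (head d) → In (tail d))

    balanced-rev : ∀ {d} → Balanced d → Balanced (rev d)
    balanced-rev {d} = subst (λ d′ → (In (tail d′) → In (head d)) × (In (head d) → In (tail d′))
                                     → Balanced (rev d))
                             (rev-involutive d) swap

    module _ (d : Dart numEdges) (others : ∀ d′ → face d′ ≡ face d → d′ ≢ d → Balanced d′) where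

      walk : ∀ {x} → Orbit nextOnFace x d → face x ≡ face d →
             (In (tail x) → In (tail d)) × (In (tail d) → In (tail x))
      walk ε _ = (λ i → i) , (λ i → i)
      -- The orbit may visit `d` before its end, and `others` says nothing about `d`, so the walk
      -- stops at the first visit.
      walk {x} (refl ◅ p) x~d with x ≟ᵈ d
      ... | yes refl = (λ i → i) , (λ i → i)
      ... | no  x≢d with others x x~d x≢d | walk p (trans (face-next x) x~d)
      ...   | x→ , ←x | n→ , ←n =
        (λ i → n→ (subst In (sym (tail-next x)) (x→ i))) , (λ i → ←x (subst In (tail-next x) (←n i)))

      -- The rest of the face boundary leads from the head of `d` back to its tail, and every dart
      -- on it preserves membership in `In` both ways.
      face-balance : Balanced d
      face-balance with walk (Equivalence.to (face-orbit (nextOnFace d) d) (face-next d)) (face-next d)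
      ... | n→ , ←n = (λ i → subst In (tail-next d) (←n i)) , (λ i → n→ (subst In (sym (tail-next d)) i))

-- The rotation of a set of faces

module _ {G : Graph} {ℰ : PlanarEmbedding G} (R : OrthogonalRepresentation ℰ)
         {S : List (PlanarEmbedding.Face ℰ)} {C : List (Graph.Vertex G)}
         (S! : Unique S) (C! : Unique C)
         (cover : ∀ d → PlanarEmbedding.face ℰ d ∈ S → Graph.tail G d ∈ C) where
  open Graph G
  open PlanarEmbedding ℰ
  open OrthogonalRepresentation R

  -- Indicators of: the right side lies in S, the tail lies in C, the dart leaves S,
  -- the tail lies in C but both sides lie outside S (given the cover hypothesis).
  inS onC boundary stray slack : Dart numEdges → ℤ
  inS d = ⟦ face d ∈? S ⟧
  onC d = ⟦ tail d ∈? C ⟧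
  boundary d = inS d * (1ℤ - inS (rev d))
  stray d = (onC d - inS d) * (1ℤ - inS (rev d))
  slack d = boundary d * (rotE d - 1ℤ) + stray d

  private
    Σᵈ : (Dart numEdges → ℤ) → ℤ
    Σᵈ = sumOver darts

  onC-inS : ∀ d → onC d * inS d ≡ inS d
  onC-inS d with face d ∈? S | tail d ∈? C
  ... | yes f∈ | yes _ = refl
  ... | yes f∈ | no t∉ = contradiction (cover d f∈) t∉
  ... | no  _  | yes _ = refl
  ... | no  _  | no  _ = refl

  rotation-split : sumOver S faceRotation ≡ Σᵈ (λ d → inS d * rotE d) + Σᵈ (λ d → inS d * rotV d)
  rotation-split = trans
    (sumOver-+ S (λ f → sumOver (dartsOn f) rotE) (λ f → sumOver (dartsOn f) rotV))
    (cong₂ _+_ (sumOver-fibres Fin._≟_ face darts rotE S!) (sumOver-fibres Fin._≟_ face darts rotV S!))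

  -- An edge with both sides in `S` contributes the rotations of both its darts, and these are
  -- opposite.
  interior-edges-cancel : Σᵈ (λ d → inS d * rotE d) ≡ Σᵈ (λ d → boundary d * rotE d)
  interior-edges-cancel = begin
    Σᵈ (λ d → inS d * rotE d)
      ≡⟨ sumOver-cong darts (λ d → split (inS d) (inS (rev d)) (rotE d)) ⟩
    Σᵈ (λ d → boundary d * rotE d + inS d * inS (rev d) * rotE d)
      ≡⟨ sumOver-+ darts _ _ ⟩
    Σᵈ (λ d → boundary d * rotE d) + Σᵈ (λ d → inS d * inS (rev d) * rotE d)
      ≡⟨ cong (_+_ (Σᵈ (λ d → boundary d * rotE d))) (sumOver-antisym numEdges _ anti) ⟩
    Σᵈ (λ d → boundary d * rotE d) + 0ℤ
      ≡⟨ ℤ.+-identityʳ _ ⟩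
    Σᵈ (λ d → boundary d * rotE d) ∎
    where
    open ≡-Reasoning
    split : ∀ a b r → a * r ≡ a * (1ℤ - b) * r + a * b * r
    split = solve-∀
    swap-neg : ∀ a b r → a * b * (- r) ≡ - (b * a * r)
    swap-neg = solve-∀
    anti : ∀ d → inS d * inS (rev d) * rotE d ≡ - (inS (rev d) * inS (rev (rev d)) * rotE (rev d))
    anti d rewrite rev-involutive d =
      trans (cong (inS d * inS (rev d) *_) (edge-antisym d)) (swap-neg (inS d) (inS (rev d)) (rotE (rev d)))

  rotV≤1 : ∀ d → rotV d ≤ 1ℤ
  rotV≤1 d with rotV d | rotV-values d
  ... | _ | inj₁ refl        = ℤ.-≤+
  ... | _ | inj₂ (inj₁ refl) = ℤ.+≤+ z≤n
  ... | _ | inj₂ (inj₂ refl) = ℤ.≤-refl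

  -- A corner in `S` gives equality. Any other corner has 0 on the right, and its rotation minus 1
  -- is at most 0.
  vertex-lower : ∀ d → rotV d + (inS d - 1ℤ) ≤ inS d * rotV d
  vertex-lower d with face d ∈? S
  ... | yes _ = ℤ.≤-reflexive (eq (rotV d))
    where
    eq : ∀ v → v + (1ℤ - 1ℤ) ≡ 1ℤ * v
    eq = solve-∀
  ... | no _ = ≤-by-difference (eq (rotV d)) (rotV≤1 d)
    where
    eq : ∀ v → 1ℤ - v ≡ 0ℤ * v - (v + (0ℤ - 1ℤ))
    eq = solve-∀

  -- The corners around `v` have total rotation 2 deg v - 4, and each corner outside `S` costs at
  -- most 1 of it. What remains is deg v - 4 plus the number of corners in `S`.
  vertex-bound : ∀ v → sumOver (dartsAt v) (λ d → 1ℤ + inS d) - + 4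
                         ≤ sumOver (dartsAt v) (λ d → inS d * rotV d)
  vertex-bound v = ℤ.≤-trans (ℤ.≤-reflexive eq) (sumOver-mono (dartsAt v) vertex-lower)
    where
    open ≡-Reasoning
    I = sumOver (dartsAt v) inS
    rearrange : ∀ n i → (1ℤ * n + i) - + 4 ≡ + 2 * (n - + 2) + (i - 1ℤ * n)
    rearrange = solve-∀
    eq : sumOver (dartsAt v) (λ d → 1ℤ + inS d) - + 4
         ≡ sumOver (dartsAt v) (λ d → rotV d + (inS d - 1ℤ))
    eq = begin
      sumOver (dartsAt v) (λ d → 1ℤ + inS d) - + 4
        ≡⟨ cong (_- + 4) (trans (sumOver-+ (dartsAt v) (λ _ → 1ℤ) inS) (cong (_+ I) (sumOver-const (dartsAt v) 1ℤ))) ⟩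
      (1ℤ * + degree v + I) - + 4
        ≡⟨ rearrange (+ degree v) I ⟩
      + 2 * (+ degree v - + 2) + (I - 1ℤ * + degree v)
        ≡⟨ cong₂ _+_ (vertex-sum v) (trans (sumOver-- (dartsAt v) inS (λ _ → 1ℤ))
                                           (cong (λ k → I - k) (sumOver-const (dartsAt v) 1ℤ))) ⟨
      sumOver (dartsAt v) rotV + sumOver (dartsAt v) (λ d → inS d - 1ℤ)
        ≡⟨ sumOver-+ (dartsAt v) rotV (λ d → inS d - 1ℤ) ⟨
      sumOver (dartsAt v) (λ d → rotV d + (inS d - 1ℤ)) ∎

  angle-bound : Σᵈ (λ d → onC d * (1ℤ + inS d)) - + 4 * + length C ≤ Σᵈ (λ d → inS d * rotV d)
  angle-bound = begin
    Σᵈ (λ d → onC d * (1ℤ + inS d)) - + 4 * + length C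
      ≡⟨ cong₂ _-_ (sumOver-fibres Fin._≟_ tail darts (λ d → 1ℤ + inS d) C!) (sumOver-const C (+ 4)) ⟨
    sumOver C (λ v → sumOver (dartsAt v) (λ d → 1ℤ + inS d)) - sumOver C (λ _ → + 4)
      ≡⟨ sumOver-- C (λ v → sumOver (dartsAt v) (λ d → 1ℤ + inS d)) (λ _ → + 4) ⟨
    sumOver C (λ v → sumOver (dartsAt v) (λ d → 1ℤ + inS d) - + 4)
      ≤⟨ sumOver-mono C vertex-bound ⟩
    sumOver C (λ v → sumOver (dartsAt v) (λ d → inS d * rotV d))
      ≡⟨ sumOver-fibres Fin._≟_ tail darts (λ d → inS d * rotV d) C! ⟩
    Σᵈ (λ d → onC d * (inS d * rotV d))
      ≡⟨ sumOver-cong darts (λ d → trans (sym (ℤ.*-assoc (onC d) (inS d) (rotV d)))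
                                         (cong (_* rotV d) (onC-inS d))) ⟩
    Σᵈ (λ d → inS d * rotV d) ∎
    where open ℤ.≤-Reasoning

  -- The corner preceding ccw d lies on the face to the left of d, so the corners
  -- outside S can equally be counted by their clockwise darts.
  corner-shift : Σᵈ (λ d → onC d * (1ℤ - inS (rev d))) ≤ Σᵈ (λ d → onC d * (1ℤ - inS d))
  corner-shift = begin
    Σᵈ (λ d → onC d * (1ℤ - inS (rev d)))
      ≡⟨ sumOver-cong darts (λ d → cong₂ (λ v f → ⟦ v ∈? C ⟧ * (1ℤ - ⟦ f ∈? S ⟧)) (tail-ccw ℰ d) (face-ccw ℰ d)) ⟨
    Σᵈ (λ d → w (Inverse.to ccw d))
      ≡⟨ sumOver-map (Inverse.to ccw) darts w ⟨
    sumOver (map (Inverse.to ccw) darts) w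
      ≤⟨ sumOver-⊆ nonneg (Unique.map⁺ injective (allDarts-unique numEdges)) (λ {d} _ → ∈-allDarts d) ⟩
    Σᵈ w ∎
    where
    open ℤ.≤-Reasoning
    w : Dart numEdges → ℤ
    w d = onC d * (1ℤ - inS d)
    nonneg : ∀ d → 0ℤ ≤ w d
    nonneg d with tail d ∈? C | face d ∈? S
    ... | yes _ | yes _ = ℤ.≤-refl
    ... | yes _ | no  _ = ℤ.+≤+ z≤n
    ... | no  _ | yes _ = ℤ.≤-refl
    ... | no  _ | no  _ = ℤ.≤-refl
    injective : ∀ {d d′} → Inverse.to ccw d ≡ Inverse.to ccw d′ → d ≡ d′
    injective eq = trans (sym (Inverse.strictlyInverseʳ ccw _))
                         (trans (cong (Inverse.from ccw) eq) (Inverse.strictlyInverseʳ ccw _))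

  -- An edge with both sides in `S` receives 2 from each dart; an edge with one side in `S` receives
  -- 2 from `inS` and 2 from `boundary`, both at the dart that leaves `S`.
  touched-count : Σᵈ (λ d → + 2 * inS d + + 2 * boundary d) ≡ + 4 * + length (touchedEdges ℰ S)
  touched-count = begin
    Σᵈ (λ d → + 2 * inS d + + 2 * boundary d)
      ≡⟨ sumOver-allDarts numEdges _ ⟩
    sumOver (allFin numEdges) (λ e → (+ 2 * inS (e , true) + + 2 * boundary (e , true))
                                   + (+ 2 * inS (e , false) + + 2 * boundary (e , false)))
      ≡⟨ sumOver-cong (allFin numEdges) per-edge ⟩
    sumOver (allFin numEdges) (λ e → ⟦ touches? ℰ S (e , true) ⟧ * + 4)
      ≡⟨ sumOver-filter (λ e → touches? ℰ S (e , true)) (allFin numEdges) (λ _ → + 4) ⟨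
    sumOver (touchedEdges ℰ S) (λ _ → + 4)
      ≡⟨ sumOver-const (touchedEdges ℰ S) (+ 4) ⟩
    + 4 * + length (touchedEdges ℰ S) ∎
    where
    open ≡-Reasoning
    per-edge : ∀ e → (+ 2 * inS (e , true) + + 2 * boundary (e , true))
                     + (+ 2 * inS (e , false) + + 2 * boundary (e , false))
                     ≡ ⟦ touches? ℰ S (e , true) ⟧ * + 4
    per-edge e with face (e , true) ∈? S | face (e , false) ∈? S
    ... | yes _ | yes _ = refl
    ... | yes _ | no  _ = refl
    ... | no  _ | yes _ = refl
    ... | no  _ | no  _ = refl

  -- The face conditions summed over `S`: edge rotations survive on the boundary only, and angles
  -- are estimated by `angle-bound`. Since a face will contribute 4 to the rotation, the terms other
  -- than `slack` amount to four times the Euler characteristic of the closure of `S`. `slack`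
  -- collects the excess over 1 on the boundary and the stray darts.
  region-bound : Σᵈ slack + + 4 * + length (touchedEdges ℰ S)
                   ≤ + 4 * + length C + sumOver S faceRotation
  region-bound = begin
    Σᵈ slack + + 4 * + length (touchedEdges ℰ S)
      ≡⟨ cong (_+_ (Σᵈ slack)) touched-count ⟨
    Σᵈ slack + Σᵈ (λ d → + 2 * inS d + + 2 * boundary d)
      ≡⟨ sumOver-+ darts slack _ ⟨
    Σᵈ (λ d → slack d + (+ 2 * inS d + + 2 * boundary d))
      ≡⟨ sumOver-cong darts (λ d → regroup (onC d) (inS d) (inS (rev d)) (rotE d)) ⟩
    Σᵈ (λ d → boundary d * rotE d + (onC d * (1ℤ - inS (rev d)) + + 2 * inS d))
      ≡⟨ trans (sumOver-+ darts (λ d → boundary d * rotE d) _)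
               (cong (_+_ X) (sumOver-+ darts (λ d → onC d * (1ℤ - inS (rev d))) (λ d → + 2 * inS d))) ⟩
    X + (Σᵈ (λ d → onC d * (1ℤ - inS (rev d))) + W)
      ≤⟨ ℤ.+-monoʳ-≤ X (ℤ.+-monoˡ-≤ W corner-shift) ⟩
    X + (Σᵈ (λ d → onC d * (1ℤ - inS d)) + W)
      ≡⟨ cong (_+_ X) (trans (sym (sumOver-+ darts (λ d → onC d * (1ℤ - inS d)) (λ d → + 2 * inS d)))
                             (sumOver-cong darts corners)) ⟩
    X + Z
      ≡⟨ add-sub X Z (+ 4 * + length C) ⟩
    + 4 * + length C + (X + (Z - + 4 * + length C))
      ≤⟨ ℤ.+-monoʳ-≤ (+ 4 * + length C) (ℤ.+-monoʳ-≤ X angle-bound) ⟩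
    + 4 * + length C + (X + Σᵈ (λ d → inS d * rotV d))
      ≡⟨ cong (_+_ (+ 4 * + length C))
              (trans rotation-split (cong (_+ Σᵈ (λ d → inS d * rotV d)) interior-edges-cancel)) ⟨
    + 4 * + length C + sumOver S faceRotation ∎
    where
    open ℤ.≤-Reasoning
    X = Σᵈ (λ d → boundary d * rotE d)
    W = Σᵈ (λ d → + 2 * inS d)
    Z = Σᵈ (λ d → onC d * (1ℤ + inS d))
    regroup : ∀ c s s′ r →
      (s * (1ℤ - s′) * (r - 1ℤ) + (c - s) * (1ℤ - s′)) + (+ 2 * s + + 2 * (s * (1ℤ - s′)))
      ≡ s * (1ℤ - s′) * r + (c * (1ℤ - s′) + + 2 * s)
    regroup = solve-∀
    add-sub : ∀ x z k → x + z ≡ k + (x + (z - k))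
    add-sub = solve-∀
    expand : ∀ c s → c * (1ℤ - s) + + 2 * (c * s) ≡ c * (1ℤ + s)
    expand = solve-∀
    corners : ∀ d → onC d * (1ℤ - inS d) + + 2 * inS d ≡ onC d * (1ℤ + inS d)
    corners d = trans (cong (λ k → onC d * (1ℤ - inS d) + + 2 * k) (sym (onC-inS d))) (expand (onC d) (inS d))

  -- The outer face contributes -4, which is 8 less than the 4 of an inner face.
  total-rotation : sumOver S faceRotation ≡ + 4 * + length S - + 8 * ⟦ outerFace ∈? S ⟧
  total-rotation = begin
    sumOver S faceRotation
      ≡⟨ sumOver-cong S per-face ⟩
    sumOver S (λ f → + 4 - + 8 * ⟦ outerFace Fin.≟ f ⟧)
      ≡⟨ sumOver-- S (λ _ → + 4) (λ f → + 8 * ⟦ outerFace Fin.≟ f ⟧) ⟩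
    sumOver S (λ _ → + 4) - sumOver S (λ f → + 8 * ⟦ outerFace Fin.≟ f ⟧)
      ≡⟨ cong₂ _-_ (sumOver-const S (+ 4)) (trans (sumOver-*ˡ S (+ 8) (λ f → ⟦ outerFace Fin.≟ f ⟧))
                                                  (cong (+ 8 *_) (sumOver-indicator Fin._≟_ outerFace S!))) ⟩
    + 4 * + length S - + 8 * ⟦ outerFace ∈? S ⟧ ∎
    where
    open ≡-Reasoning
    per-face : ∀ f → faceRotation f ≡ + 4 - + 8 * ⟦ outerFace Fin.≟ f ⟧
    per-face f with outerFace Fin.≟ f
    ... | yes refl = outer-face
    ... | no  o≢f  = inner-face f (λ f≡o → o≢f (sym f≡o))

  slack-boundary : ∀ d → face d ∈ S → face (rev d) ∉ S → slack d ≡ rotE d - 1ℤ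
  slack-boundary d f∈ f∉ with face d ∈? S | face (rev d) ∈? S | tail d ∈? C
  ... | no f∉S | _      | _     = contradiction f∈ f∉S
  ... | yes _  | yes f∈S | _     = contradiction f∈S f∉
  ... | yes _  | no _   | no t∉ = contradiction (cover d f∈) t∉
  ... | yes _  | no _   | yes _ = eq (rotE d)
    where
    eq : ∀ r → 1ℤ * (1ℤ - 0ℤ) * (r - 1ℤ) + (1ℤ - 1ℤ) * (1ℤ - 0ℤ) ≡ r - 1ℤ
    eq = solve-∀

  slack-stray : ∀ d → tail d ∈ C → ¬ Touches ℰ S d → slack d ≡ 1ℤ
  slack-stray d t∈ ¬t with face d ∈? S | face (rev d) ∈? S | tail d ∈? C
  ... | yes f∈ | _      | _     = contradiction (inj₁ f∈) ¬t
  ... | no _   | yes f∈ | _     = contradiction (inj₂ f∈) ¬t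
  ... | no _   | no _   | no t∉ = contradiction t∈ t∉
  ... | no _   | no _   | yes _ = refl

  -- Both terms of `slack` contain the factor `1ℤ - inS (rev d)`, so only darts with their left side
  -- outside `S` matter. Such a dart leaves `S`, is stray, or has its tail outside `C` and
  -- contributes nothing.
  slack-nonneg : (∀ d → face d ∈ S → face (rev d) ∉ S → 1ℤ ≤ rotE d) → ∀ d → 0ℤ ≤ slack d
  slack-nonneg positive d = by-cases (face d ∈? S) (face (rev d) ∈? S) (tail d ∈? C)
    where
    by-cases : Dec (face d ∈ S) → Dec (face (rev d) ∈ S) → Dec (tail d ∈ C) → 0ℤ ≤ slack d
    by-cases (yes f∈) (no f∉) _ =
      subst (0ℤ ≤_) (sym (slack-boundary d f∈ f∉)) (ℤ.i≤j⇒0≤j-i (positive d f∈ f∉))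
    by-cases (no f∉) (no f′∉) (yes t∈) =
      subst (0ℤ ≤_) (sym (slack-stray d t∈ [ f∉ , f′∉ ]′)) (ℤ.+≤+ z≤n)
    by-cases (no f∉) (no _) (no t∉) =
      ℤ.≤-reflexive (sym (cong₂ (λ s c → s * s′ * (rotE d - 1ℤ) + (c - s) * s′)
                                (⟦⟧-no (face d ∈? S) f∉) (⟦⟧-no (tail d ∈? C) t∉)))
      where s′ = 1ℤ - inS (rev d)
    by-cases _ (yes f∈) _ =
      ℤ.≤-reflexive (sym (trans (cong (λ s′ → inS d * (1ℤ - s′) * (rotE d - 1ℤ) + (onC d - inS d) * (1ℤ - s′))
                                       (⟦⟧-yes (face (rev d) ∈? S) f∈))
                                (eq (inS d) (rotE d) (onC d))))
      where
      eq : ∀ s r c → s * (1ℤ - 1ℤ) * (r - 1ℤ) + (c - s) * (1ℤ - 1ℤ) ≡ 0ℤ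
      eq = solve-∀

-- Counting the closure of a region of faces

module _ {G : Graph} {ℰ : PlanarEmbedding G} (R : OrthogonalRepresentation ℰ)
         (d₀ : Dart (Graph.numEdges G)) where
  open Graph G
  open PlanarEmbedding ℰ
  open OrthogonalRepresentation R

  -- Adding 1 to such a rotation costs a bend only if it was 0.
  Raisable : Dart numEdges → Set
  Raisable d = rotE d ≤ 0ℤ

  RegionTree : List Face → List (Dart numEdges) → Set
  RegionTree = Tree face Raisable (face d₀)

  module _ {S : List Face} {ds : List (Dart numEdges)} (t : RegionTree S ds)
           (d₀-exits : face (rev d₀) ∉ S) where

    dualTreeEdges : List Edge
    dualTreeEdges = edgeOf d₀ ∷ map edgeOf ds

    -- A tree-cotree decomposition of the closure of `S`: the dual tree spans `S`, with `d₀` linking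
    -- it to the complement, and the primal tree is grown from the remaining touched edges.
    Primal : Dart numEdges → Set
    Primal d = Touches ℰ S d × edgeOf d ∉ dualTreeEdges

    open DecMembership (Fin._≟_ {numEdges}) using () renaming (_∈?_ to _∈ᵉ?_)

    primal? : ∀ d → Dec (Primal d)
    primal? d = touches? ℰ S d ×-dec ¬? (edgeOf d ∈ᵉ? dualTreeEdges)

    -- The latest face of the tree has no other tree edge on its boundary than the
    -- one it was reached by, so that edge is balanced by walking round the face.
    balance : (In : Vertex → Set) → ∀ {xs es} → RegionTree xs es → xs ⊆ S →
              (∀ d → Touches ℰ S d → edgeOf d ∉ edgeOf d₀ ∷ map edgeOf es → Balanced ℰ In d) →
              ∀ d → Touches ℰ S d → Balanced ℰ In d
    balance In root sub hyp d touch with edgeOf d Fin.≟ edgeOf d₀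
    ... | no e≢ = hyp d touch λ { (here eq) → e≢ eq }
    ... | yes eq = [ (λ { refl → balanced₀ }) , (λ { refl → balanced-rev ℰ In balanced₀ }) ]′ (same-edge d d₀ eq)
      where
      balanced₀ : Balanced ℰ In d₀
      balanced₀ = face-balance ℰ In d₀ λ d′ d′~d₀ d′≢d₀ →
        hyp d′ (inj₁ (subst (_∈ S) (sym d′~d₀) (sub (here refl)))) λ
          { (here eq) → [ d′≢d₀ , (λ { refl → d₀-exits (subst (_∈ S) (sym d′~d₀) (sub (here refl))) }) ]′
                        (same-edge d′ d₀ eq) }
    balance In {h ∷ xs} {p ∷ es} (grow p t′ _ p∈ new) sub hyp =
      balance In t′ (λ x∈ → sub (there x∈)) hyp′
      where
      -- The latest face is new, whereas `d₀` has its right side in the older tree and its left side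
      -- outside `S`, and the older tree edges have both sides in the older tree.
      others : ∀ d′ → face d′ ≡ face (rev p) → d′ ≢ rev p → edgeOf d′ ∉ edgeOf d₀ ∷ edgeOf p ∷ map edgeOf es
      others d′ d′~ d′≢ (here eq) with same-edge d′ d₀ eq
      ... | inj₁ refl = new (subst (_∈ xs) d′~ (root∈tree t′))
      ... | inj₂ refl = d₀-exits (subst (_∈ S) (sym d′~) (sub (here refl)))
      others d′ d′~ d′≢ (there (here eq)) with same-edge d′ p eq
      ... | inj₁ refl = new (subst (_∈ xs) d′~ p∈)
      ... | inj₂ d′≡  = d′≢ d′≡
      others d′ d′~ d′≢ (there (there e∈)) = new (subst (_∈ xs) d′~ (tree-edge-end t′ d′ e∈))
      balanced-p : Balanced ℰ In (rev p)
      balanced-p = face-balance ℰ In (rev p) λ d′ d′~ d′≢ →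
        hyp d′ (inj₁ (subst (_∈ S) (sym d′~) (sub (here refl)))) (others d′ d′~ d′≢)
      hyp′ : ∀ d → Touches ℰ S d → edgeOf d ∉ edgeOf d₀ ∷ map edgeOf es → Balanced ℰ In d
      hyp′ d touch e∉ with edgeOf d Fin.≟ edgeOf p
      ... | no e≢ = hyp d touch λ
        { (here eq) → e∉ (here eq) ; (there (here eq)) → e≢ eq ; (there (there e∈)) → e∉ (there e∈) }
      ... | yes eq with same-edge d p eq
      ...   | inj₁ refl = subst (Balanced ℰ In) (rev-involutive d) (balanced-rev ℰ In balanced-p)
      ...   | inj₂ refl = balanced-p

    module _ {C : List Vertex} {cs : List (Dart numEdges)} (tC : Tree tail Primal (tail d₀) C cs)
             (closedC : ∀ d → Primal d → tail d ∈ C → head d ∈ C) where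

      -- Edges outside the dual tree are balanced because `C` is closed under primal darts;
      -- `balance` then adds the dual tree edges, latest first, and finally `d₀`.
      touching-balanced : ∀ d → Touches ℰ S d → Balanced ℰ (_∈ C) d
      touching-balanced = balance (_∈ C) t (λ x∈ → x∈) λ d touch e∉ →
        closedC d (touch , e∉) ,
        λ h∈ → subst (λ d′ → tail d′ ∈ C) (rev-involutive d) (closedC (rev d) (touches-rev ℰ touch , e∉) h∈)

      face-covered : ∀ d → face d ∈ S → tail d ∈ C → ∀ d′ → face d′ ≡ face d → tail d′ ∈ C
      face-covered d f∈ t∈ d′ eq = go (Equivalence.to (face-orbit d d′) (sym eq)) f∈ t∈
        where
        go : ∀ {x} → Orbit nextOnFace x d′ → face x ∈ S → tail x ∈ C → tail d′ ∈ C
        go ε _ t∈ = t∈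
        go {x} (refl ◅ p) f∈ t∈ =
          go p (subst (_∈ S) (sym (face-next ℰ x)) f∈)
               (subst (_∈ C) (sym (tail-next ℰ x)) (proj₁ (touching-balanced x (inj₁ f∈)) t∈))

      -- Induction along the dual tree. Membership in `C` passes across the balanced tree dart into
      -- the new face, and then around that face.
      covered : ∀ d → face d ∈ S → tail d ∈ C
      covered d f∈ = go t (λ x∈ → x∈) d f∈
        where
        go : ∀ {xs es} → RegionTree xs es → xs ⊆ S → ∀ d → face d ∈ xs → tail d ∈ C
        go root sub d (here eq) = face-covered d₀ (sub (here refl)) (root∈tree tC) d eq
        go (grow p t′ _ p∈ _) sub d (here eq) =
          face-covered (rev p) (sub (here refl))
            (proj₁ (touching-balanced p (inj₁ (sub (there p∈)))) (go t′ (λ x∈ → sub (there x∈)) p p∈)) d eq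
        go (grow p t′ _ _ _) sub d (there f∈) = go t′ (λ x∈ → sub (there x∈)) d f∈

      counted : List Edge
      counted = dualTreeEdges ++ map edgeOf cs

      counted-unique : Unique counted
      counted-unique = Unique.++⁺
        -- Dual tree edges have both sides in `S`, but the left side of `d₀` is outside.
        (∉⇒All≢ (λ e∈ → d₀-exits (tree-edge-end t (rev d₀) e∈)) ∷ tree-edges-unique t)
        (tree-edges-unique tC)
        disjoint
        where
        disjoint : ∀ {e} → ¬ (e ∈ dualTreeEdges × e ∈ map edgeOf cs)
        disjoint (e∈T , e∈C) with ∈-map⁻ edgeOf e∈C
        ... | d , d∈ , refl = proj₂ (proj₁ (tree-ends tC d∈)) e∈T

      counted-touched : counted ⊆ touchedEdges ℰ S
      counted-touched e∈ with ∈-++⁻ dualTreeEdges e∈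
      ... | inj₁ (here refl) = ∈-touchedEdges ℰ d₀ (inj₁ (root∈tree t))
      ... | inj₁ (there e∈T) with ∈-map⁻ edgeOf e∈T
      ...   | d , d∈ , refl = ∈-touchedEdges ℰ d (inj₁ (proj₁ (proj₂ (tree-ends t d∈))))
      counted-touched e∈ | inj₂ e∈C with ∈-map⁻ edgeOf e∈C
      ...   | d , d∈ , refl = ∈-touchedEdges ℰ d (proj₁ (proj₁ (tree-ends tC d∈)))

      -- The |C| - 1 primal tree edges, the |S| - 1 dual tree edges and `d₀` are distinct touched
      -- edges. This is the bound 1 on the Euler characteristic of the closure; it is `d₀` that
      -- lowers it from 2.
      region-euler : length C ℕ.+ length S ℕ.≤ suc (length (touchedEdges ℰ S))
      region-euler = begin
        length C ℕ.+ length S                                       ≡⟨ cong₂ ℕ._+_ (tree-length tC) (tree-length t) ⟩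
        suc (length cs ℕ.+ suc (length ds))                         ≡⟨ cong suc (ℕ.+-comm (length cs) _) ⟩
        suc (suc (length ds) ℕ.+ length cs)
          ≡⟨ cong₂ (λ a b → suc (suc a ℕ.+ b)) (List.length-map edgeOf ds) (List.length-map edgeOf cs) ⟨
        suc (length dualTreeEdges ℕ.+ length (map edgeOf cs))       ≡⟨ cong suc (List.length-++ dualTreeEdges) ⟨
        suc (length counted)                                        ≤⟨ s≤s (length-⊆ counted-unique counted-touched) ⟩
        suc (length (touchedEdges ℰ S))                             ∎
        where open ℕ.≤-Reasoning

-- Closed regions in a biconnected graph

module _ (G : Graph) where
  open Graph G

  crossing : ∀ {C : List Vertex} {u v} → Star Adjacent u v → u ∈ C → v ∉ C →
             ∃[ d ] (tail d ∈ C × head d ∉ C)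
  crossing ε u∈ v∉ = contradiction u∈ v∉
  crossing {C} (_◅_ {j = w} (d , refl , refl) p) u∈ v∉ with w ∈? C
  ... | yes w∈ = crossing p w∈ v∉
  ... | no  w∉ = d , u∈ , w∉

  crossing-avoiding : ∀ {C : List Vertex} {x u v} → Star (AdjacentAvoiding x) u v → u ∈ C → v ∉ C →
                      ∃[ d ] (tail d ∈ C × head d ∉ C × tail d ≢ x)
  crossing-avoiding ε u∈ v∉ = contradiction u∈ v∉
  crossing-avoiding {C} (_◅_ {j = w} ((d , refl , refl) , u≢ , _) p) u∈ v∉ with w ∈? C
  ... | yes w∈ = crossing-avoiding p w∈ v∉
  ... | no  w∉ = d , u∈ , w∉ , u≢

module _ {G : Graph} {ℰ : PlanarEmbedding G} (biconnected : Biconnected G)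
         (R : OrthogonalRepresentation ℰ) (d₀ : Dart (Graph.numEdges G))
         (many : + 4 ≤ OrthogonalRepresentation.rotE R d₀)
         {S : List (PlanarEmbedding.Face ℰ)} {ds : List (Dart (Graph.numEdges G))}
         (t : RegionTree R d₀ S ds)
         (closed : ∀ d → OrthogonalRepresentation.rotE R d ≤ 0ℤ → PlanarEmbedding.face ℰ d ∈ S →
                   PlanarEmbedding.face ℰ (rev d) ∈ S)
         (d₀-exits : PlanarEmbedding.face ℰ (rev d₀) ∉ S) where
  open Graph G
  open PlanarEmbedding ℰ
  open OrthogonalRepresentation R

  private
    primalTree : ClosedTree {end = tail} {P = Primal R d₀ t d₀-exits} {r = tail d₀}
    primalTree = search (primal? R d₀ t d₀-exits)

    open ClosedTree primalTree renaming (nodes to C; tree to tC; closed to closedC)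

    cover : ∀ d → face d ∈ S → tail d ∈ C
    cover = covered R d₀ t d₀-exits tC closedC

    S! : Unique S
    S! = tree-unique t

    C! : Unique C
    C! = tree-unique tC

    slk : Dart numEdges → ℤ
    slk = slack R S! C! cover

    d₀∈S : face d₀ ∈ S
    d₀∈S = root∈tree t

    positive : ∀ d → face d ∈ S → face (rev d) ∉ S → 1ℤ ≤ rotE d
    positive d f∈ f∉ with rotE d ℤ.≤? 0ℤ
    ... | yes r≤0 = contradiction (closed d r≤0 f∈) f∉
    ... | no  r≰0 = ℤ.i<j⇒suc[i]≤j (ℤ.≰⇒> r≰0)

    slk-nonneg : ∀ d → 0ℤ ≤ slk d
    slk-nonneg = slack-nonneg R S! C! cover positive

    bound : sumOver darts slk + + 4 * + length (touchedEdges ℰ S)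
              ≤ + 4 * + length C + (+ 4 * + length S - + 8 * ⟦ outerFace ∈? S ⟧)
    bound = subst (λ r → sumOver darts slk + + 4 * + length (touchedEdges ℰ S) ≤ + 4 * + length C + r)
                  (total-rotation R S! C! cover) (region-bound R S! C! cover)

    -- Four times `region-euler` added to `region-bound` cancels vertices, faces and edges and
    -- leaves a budget of 4, from which the outer face would take 8.
    total-slack : sumOver darts slk + + 8 * ⟦ outerFace ∈? S ⟧ ≤ + 4
    total-slack = ≤-by-difference
      (eq (sumOver darts slk) (+ length C) (+ length S) (+ length (touchedEdges ℰ S)) ⟦ outerFace ∈? S ⟧)
      (ℤ.+-mono-≤ bound (ℤ.*-monoˡ-≤-nonNeg (+ 4) (ℤ.+≤+ (region-euler R d₀ t d₀-exits tC closedC))))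
      where
      eq : ∀ σ c s e o →
           ((+ 4 * c + (+ 4 * s - + 8 * o)) + + 4 * (1ℤ + e)) - ((σ + + 4 * e) + + 4 * (c + s))
           ≡ + 4 - (σ + + 8 * o)
      eq = solve-∀

    slack-among : ∀ {xs} → Unique xs → sumOver xs slk ≤ + 4
    slack-among {xs} xs! = begin
      sumOver xs slk                                   ≤⟨ sumOver-⊆ slk-nonneg xs! (λ {d} _ → ∈-allDarts d) ⟩
      sumOver darts slk                                ≡⟨ ℤ.+-identityʳ _ ⟨
      sumOver darts slk + 0ℤ
        ≤⟨ ℤ.+-monoʳ-≤ (sumOver darts slk) (ℤ.*-monoˡ-≤-nonNeg (+ 8) (0≤⟦⟧ (outerFace ∈? S))) ⟩
      sumOver darts slk + + 8 * ⟦ outerFace ∈? S ⟧     ≤⟨ total-slack ⟩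
      + 4                                              ∎
      where open ℤ.≤-Reasoning

    slack-d₀ : + 3 ≤ slk d₀
    slack-d₀ = subst (+ 3 ≤_) (sym (slack-boundary R S! C! cover d₀ d₀∈S d₀-exits)) (ℤ.+-monoˡ-≤ (- 1ℤ) many)

    stray-slack : ∀ d → tail d ∈ C → ¬ Touches ℰ S d → slk d ≡ 1ℤ
    stray-slack = slack-stray R S! C! cover

    touching≢stray : ∀ {d} → ¬ Touches ℰ S d → d₀ ≢ d
    touching≢stray ¬t refl = ¬t (inj₁ d₀∈S)

    -- d₀ alone uses three of the four units of slack.
    no-two-strays : ∀ {d d′} → tail d ∈ C → ¬ Touches ℰ S d → tail d′ ∈ C → ¬ Touches ℰ S d′ → ¬ d ≢ d′
    no-two-strays {d} {d′} t∈ ¬t t′∈ ¬t′ d≢d′ = contradiction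
      (ℤ.≤-trans (ℤ.+-mono-≤ slack-d₀ (ℤ.≤-reflexive (sym
                   (cong₂ (λ a b → a + (b + 0ℤ)) (stray-slack d t∈ ¬t) (stray-slack d′ t′∈ ¬t′)))))
                 (slack-among ((touching≢stray ¬t ∷ touching≢stray ¬t′ ∷ []) ∷ (d≢d′ ∷ []) ∷ [] ∷ [])))
      λ { (ℤ.+≤+ (s≤s (s≤s (s≤s (s≤s ()))))) }

    head-cover : ∀ d → face d ∈ S → head d ∈ C
    head-cover d f∈ = subst (_∈ C) (tail-next ℰ d) (cover (nextOnFace d) (subst (_∈ S) (sym (face-next ℰ d)) f∈))

    exit-untouched : ∀ d → head d ∉ C → ¬ Touches ℰ S d
    exit-untouched d h∉ = [ (λ f∈ → h∉ (head-cover d f∈)) , (λ f∈ → h∉ (cover (rev d) f∈)) ]′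

    -- If `u` were missed, connectedness would give an edge leaving `C`, and as its tail is no
    -- cutvertex there would be a second one with another tail. Faces of `S` have all their vertices
    -- in `C`, so both darts are stray, which exceeds the budget.
    all-vertices : ∀ u → u ∈ C
    all-vertices u with u ∈? C
    ... | yes u∈ = u∈
    ... | no  u∉ = ⊥-elim absurd
      where
      first : ∃[ d ] (tail d ∈ C × head d ∉ C)
      first = crossing G (proj₁ biconnected (tail d₀) u) (cover d₀ d₀∈S) u∉
      d₁ = proj₁ first
      -- The two ends of `d₀` are distinct vertices of `C`, so one of them differs from the tail of
      -- `d₁`.
      other : ∃[ w ] (w ∈ C × w ≢ tail d₁)
      other with tail d₀ Fin.≟ tail d₁
      ... | no  neq = tail d₀ , cover d₀ d₀∈S , neq
      ... | yes same = head d₀ , head-cover d₀ d₀∈S , λ eq → loopless d₀ (trans same (sym eq))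
      absurd : ⊥
      absurd with first | other
      ... | d₁ , t∈ , h∉ | w , w∈ , w≢ with crossing-avoiding G
              (proj₂ biconnected (tail d₁) w u w≢ (λ eq → u∉ (subst (_∈ C) (sym eq) t∈))) w∈ u∉
      ...   | d₂ , t₂∈ , h₂∉ , apart =
        no-two-strays t∈ (exit-untouched d₁ h∉) t₂∈ (exit-untouched d₂ h₂∉) (λ { refl → apart refl })

    -- Both ends of an untouched edge lie in `C`, so its two darts would be two strays.
    all-touched : ∀ d → Touches ℰ S d
    all-touched d with touches? ℰ S d
    ... | yes touch = touch
    ... | no  ¬t = contradiction (λ eq → rev-≢ d (sym eq))
      (no-two-strays (all-vertices (tail d)) ¬t (all-vertices (head d))
                     (λ touch → ¬t (subst (Touches ℰ S) (rev-involutive d) (touches-rev ℰ touch))))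

    -- As every edge is touched, `region-bound` and Euler's formula give 4F + 1 ≤ 4(|S| + 2) for the
    -- number F of faces. The 1 comes from the positive slack of `d₀` and improves F ≤ |S| + 2 by
    -- one.
    all-but-one : numFaces ℕ.≤ suc (length S)
    all-but-one = ℕ.s≤s⁻¹ (ℤ.drop‿+<+ (ℤ.*-cancelˡ-<-nonNeg {+ numFaces} {+ 2 + + length S} (+ 4)
      (ℤ.suc[i]≤j⇒i<j four-times)))
      where
      1≤slack : 1ℤ ≤ sumOver darts slk
      1≤slack = ℤ.≤-trans (ℤ.≤-trans (ℤ.+≤+ (s≤s z≤n)) slack-d₀)
        (subst (_≤ sumOver darts slk) (ℤ.+-identityʳ (slk d₀))
               (sumOver-⊆ slk-nonneg ([] ∷ []) (λ {d} _ → ∈-allDarts d)))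
      edges≤ : + numEdges ≤ + length (touchedEdges ℰ S)
      edges≤ = ℤ.+≤+ (subst (ℕ._≤ length (touchedEdges ℰ S)) (length-allFin numEdges)
        (length-⊆ (Unique.allFin⁺ numEdges) (λ {e} _ → ∈-touchedEdges ℰ (e , true) (all-touched (e , true)))))
      eq : ∀ σ c s e o E V F → V + F ≡ E + + 2 →
           (σ + ((+ 4 * c + (+ 4 * s - + 8 * o)) + (+ 4 * (e + V) + + 8 * o)))
             - (1ℤ + ((σ + + 4 * e) + (+ 4 * (E + c) + + 8 * 0ℤ)))
           ≡ + 4 * (+ 2 + s) - (1ℤ + + 4 * F)
      eq σ c s e o E V F euler′ = trans (expand σ c s e o E V F)
        (trans (cong (λ x → + 4 * s + (+ 4 * x - + 4 * F - + 4 * E - 1ℤ)) euler′) (collapse s E F))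
        where
        expand : ∀ σ c s e o E V F →
           (σ + ((+ 4 * c + (+ 4 * s - + 8 * o)) + (+ 4 * (e + V) + + 8 * o)))
             - (1ℤ + ((σ + + 4 * e) + (+ 4 * (E + c) + + 8 * 0ℤ)))
           ≡ + 4 * s + (+ 4 * (V + F) - + 4 * F - + 4 * E - 1ℤ)
        expand = solve-∀
        collapse : ∀ s E F → + 4 * s + (+ 4 * (E + + 2) - + 4 * F - + 4 * E - 1ℤ)
                             ≡ + 4 * (+ 2 + s) - (1ℤ + + 4 * F)
        collapse = solve-∀
      four-times : 1ℤ + + 4 * + numFaces ≤ + 4 * (+ 2 + + length S)
      four-times = ≤-by-difference
        (eq (sumOver darts slk) (+ length C) (+ length S) (+ length (touchedEdges ℰ S)) ⟦ outerFace ∈? S ⟧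
            (+ numEdges) (+ numVertices) (+ numFaces) (cong +_ euler))
        (ℤ.+-mono-≤ 1≤slack (ℤ.+-mono-≤ bound (ℤ.+-mono-≤
          (ℤ.*-monoˡ-≤-nonNeg (+ 4) (ℤ.+-mono-≤ edges≤ (ℤ.+≤+ (length-Fin C!))))
          (ℤ.*-monoˡ-≤-nonNeg (+ 8) (0≤⟦⟧ (outerFace ∈? S))))))

  outer∉ : outerFace ∉ S
  outer∉ o∈ = contradiction
    (ℤ.≤-trans (ℤ.+-mono-≤ (sumOver-nonneg darts slk-nonneg)
                            (ℤ.≤-reflexive (cong (+ 8 *_) (sym (⟦⟧-yes (outerFace ∈? S) o∈)))))
               total-slack)
    λ { (ℤ.+≤+ (s≤s (s≤s (s≤s (s≤s ()))))) }

  -- A further face outside `S` would make |S| + 2 distinct faces together with the outer one.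
  outside-outer : ∀ f → f ∉ S → f ≡ outerFace
  outside-outer f f∉ with f Fin.≟ outerFace
  ... | yes eq = eq
  ... | no  f≢ = contradiction
    (ℕ.≤-trans (length-Fin ((f≢ ∷ ∉⇒All≢ f∉) ∷ ∉⇒All≢ outer∉ ∷ S!)) all-but-one) ℕ.1+n≰n

  exit-rotation : rotE d₀ ≤ + 5
  exit-rotation = ≤-by-difference (eq (rotE d₀)) (subst (_≤ + 4)
    (trans (ℤ.+-identityʳ _) (slack-boundary R S! C! cover d₀ d₀∈S d₀-exits)) (slack-among ([] ∷ [])))
    where
    eq : ∀ r → + 4 - (r - 1ℤ) ≡ + 5 - r
    eq = solve-∀

  -- `d₀` takes at least 3 of the 4 units of slack, so at most 1 is left for `d`, whose slack is its
  -- rotation minus 1.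
  other-exit-rotation : ∀ d → face d ∈ S → face (rev d) ∉ S → d₀ ≢ d → rotE d ≤ + 2
  other-exit-rotation d f∈ f∉ d₀≢d = ≤-by-difference (eq (slk d₀) (rotE d))
    (ℤ.+-mono-≤ slack-d₀ (subst (λ r → slk d₀ + r ≤ + 4)
      (trans (ℤ.+-identityʳ _) (slack-boundary R S! C! cover d f∈ f∉)) (slack-among ((d₀≢d ∷ []) ∷ [] ∷ []))))
    where
    eq : ∀ σ r → (σ + + 4) - (+ 3 + (σ + (r - 1ℤ))) ≡ + 2 - r
    eq = solve-∀

-- Rerouting rotation along a path of faces

-- One unit of rotation moved from the face left of `p` to the face right of `p`.
unitFlow : ∀ {m} → Dart m → Dart m → ℤ
unitFlow p d = ⟦ p ≟ᵈ d ⟧ - ⟦ rev p ≟ᵈ d ⟧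

unitFlow-antisym : ∀ {m} (p d : Dart m) → unitFlow p d ≡ - unitFlow p (rev d)
unitFlow-antisym p d = trans
  (cong₂ _-_ (⟦⟧-cong (p ≟ᵈ d) (rev p ≟ᵈ rev d) (cong rev) rev-injective)
             (⟦⟧-cong (rev p ≟ᵈ d) (p ≟ᵈ rev d)
                (λ eq → trans (sym (rev-involutive p)) (cong rev eq))
                (λ eq → trans (cong rev eq) (rev-involutive d))))
  (flip-sub ⟦ rev p ≟ᵈ rev d ⟧ ⟦ p ≟ᵈ rev d ⟧)
  where
  flip-sub : ∀ a b → a - b ≡ - (b - a)
  flip-sub = solve-∀

unitFlow-self : ∀ {m} (p : Dart m) → unitFlow p p ≡ 1ℤ
unitFlow-self p = cong₂ _-_ (⟦⟧-yes (p ≟ᵈ p) refl) (⟦⟧-no (rev p ≟ᵈ p) (rev-≢ p))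

unitFlow-other : ∀ {m} (p d : Dart m) → edgeOf p ≢ edgeOf d → unitFlow p d ≡ 0ℤ
unitFlow-other p d e≢ =
  cong₂ _-_ (⟦⟧-no (p ≟ᵈ d) (λ eq → e≢ (cong edgeOf eq))) (⟦⟧-no (rev p ≟ᵈ d) (λ eq → e≢ (cong edgeOf eq)))

-- The changes by at most one unit that move a nonzero rotation towards 0. From 0 both directions
-- are allowed, which creates a single bend.
data Change (r : ℤ) : ℤ → Set where
  keep  : Change r 0ℤ
  raise : r ≤ 0ℤ → Change r 1ℤ
  lower : 0ℤ ≤ r → Change r -1ℤ

change-bends : ∀ {r δ} → Change r δ → ∣ r + δ ∣ ℕ.≤ ∣ r ∣ ⊎ ∣ r + δ ∣ ℕ.≤ 1
change-bends {r} keep = inj₁ (ℕ.≤-reflexive (cong ∣_∣ (ℤ.+-identityʳ r)))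
change-bends {+ 0}            (raise _) = inj₂ ℕ.≤-refl
change-bends {+ suc _}        (raise (ℤ.+≤+ ()))
change-bends { -[1+ 0 ]}      (raise _) = inj₁ z≤n
change-bends { -[1+ suc n ]}  (raise _) = inj₁ (ℕ.n≤1+n _)
change-bends {+ 0}            (lower _) = inj₂ ℕ.≤-refl
change-bends {+ suc n}        (lower _) = inj₁ (ℕ.n≤1+n _)
change-bends { -[1+ _ ]}      (lower ())

change-neg : ∀ {r δ} → Change r δ → Change (- r) (- δ)
change-neg keep        = keep
change-neg (raise r≤0) = lower (ℤ.neg-mono-≤ r≤0)
change-neg (lower 0≤r) = raise (ℤ.neg-mono-≤ 0≤r)

-- A rotation of at least 4 is not raised by the path, so it drops by 1 or 2 in total and stays
-- positive.
lowered-bends : ∀ {r δ} → + 4 ≤ r → Change r δ → ∣ r + (δ - 1ℤ) ∣ ℕ.< ∣ r ∣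
lowered-bends (ℤ.+≤+ (s≤s (s≤s _))) keep                 = ℕ.≤-refl
lowered-bends (ℤ.+≤+ (s≤s (s≤s _))) (raise (ℤ.+≤+ ()))
lowered-bends (ℤ.+≤+ (s≤s (s≤s _))) (lower _)            = ℕ.n≤1+n _

module _ {G : Graph} {ℰ : PlanarEmbedding G} (R : OrthogonalRepresentation ℰ)
         (d₀ : Dart (Graph.numEdges G)) where
  open Graph G
  open PlanarEmbedding ℰ
  open OrthogonalRepresentation R

  divergence : Face → Face → Face → ℤ
  divergence f h a = ⟦ f Fin.≟ a ⟧ - ⟦ h Fin.≟ a ⟧

  unitFlow-divergence : ∀ p a → sumOver (dartsOn a) (unitFlow p) ≡ divergence (face p) (face (rev p)) a
  unitFlow-divergence p a = trans (sumOver-- (dartsOn a) (λ d → ⟦ p ≟ᵈ d ⟧) (λ d → ⟦ rev p ≟ᵈ d ⟧))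
                                  (cong₂ _-_ (at p) (at (rev p)))
    where
    on? : ∀ d → Dec (face d ≡ a)
    on? d = face d Fin.≟ a
    at : ∀ p → sumOver (dartsOn a) (λ d → ⟦ p ≟ᵈ d ⟧) ≡ ⟦ face p Fin.≟ a ⟧
    at p = trans (sumOver-indicator _≟ᵈ_ p (Unique.filter⁺ on? (allDarts-unique numEdges)))
                 (⟦⟧-cong _ (face p Fin.≟ a) (λ p∈ → proj₂ (∈-filter⁻ on? {xs = darts} p∈))
                                             (∈-filter⁺ on? (∈-allDarts p)))

  -- A unit flow along a path of faces from that of `d₀` to `h`. By `support` an edge towards a face
  -- outside `xs` carries no flow yet, so extending the path over it changes that edge only once.
  record Flow (xs : List Face) (h : Face) : Set where
    field
      flow        : Dart numEdges → ℤ
      antisym     : ∀ d → flow d ≡ - flow (rev d)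
      conserved   : ∀ a → sumOver (dartsOn a) flow ≡ divergence (face d₀) h a
      admissible  : ∀ d → Change (rotE d) (flow d)
      support     : ∀ d → face d ∉ xs → flow d ≡ 0ℤ

  push : ∀ {xs ds h} → RegionTree R d₀ xs ds → h ∈ xs → Flow xs h
  push root (here refl) = record
    { flow       = λ _ → 0ℤ
    ; antisym    = λ _ → refl
    ; conserved  = λ a → trans (sumOver-0 (dartsOn a)) (sym (ℤ.+-inverseʳ ⟦ face d₀ Fin.≟ a ⟧))
    ; admissible = λ _ → keep
    ; support    = λ _ _ → refl
    }
  push (grow p t _ _ _) (there h∈) = record
    { Flow φ
    ; support = λ d f∉ → Flow.support φ d (λ f∈ → f∉ (there f∈))
    }
    where φ = push t h∈
  push {x ∷ xs} (grow p t p≤0 p∈ new) (here refl) = record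
    { flow       = flow′
    ; antisym    = λ d → trans (cong₂ _+_ (antisym d) (unitFlow-antisym p d)) (sym (ℤ.neg-distrib-+ (flow (rev d)) _))
    ; conserved  = λ a → trans (sumOver-+ (dartsOn a) flow (unitFlow p))
        (trans (cong₂ _+_ (conserved a) (unitFlow-divergence p a)) (telescope ⟦ face d₀ Fin.≟ a ⟧ ⟦ face p Fin.≟ a ⟧ _))
    ; admissible = admissible′
    ; support    = λ d f∉ → trans (cong₂ _+_ (support d (λ f∈ → f∉ (there f∈)))
        (cong₂ _-_ (⟦⟧-no (p ≟ᵈ d) λ { refl → f∉ (there p∈) }) (⟦⟧-no (rev p ≟ᵈ d) λ { refl → f∉ (here refl) }))) refl
    }
    where
    open Flow (push t p∈)
    flow′ : Dart numEdges → ℤ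
    flow′ d = flow d + unitFlow p d
    telescope : ∀ a b c → (a - b) + (b - c) ≡ a - c
    telescope = solve-∀
    new-edge : flow p ≡ 0ℤ
    new-edge = trans (antisym p) (cong -_ (support (rev p) new))
    raised : Change (rotE p) (flow′ p)
    raised = subst (Change (rotE p)) (sym (cong₂ _+_ new-edge (unitFlow-self p))) (raise p≤0)
    admissible′ : ∀ d → Change (rotE d) (flow′ d)
    admissible′ d = by-cases d (edgeOf p Fin.≟ edgeOf d)
      where
      by-cases : ∀ d → Dec (edgeOf p ≡ edgeOf d) → Change (rotE d) (flow′ d)
      by-cases d (no e≢) = subst (Change (rotE d))
        (trans (sym (ℤ.+-identityʳ _)) (cong (_+_ (flow d)) (sym (unitFlow-other p d e≢))))
        (admissible d)
      by-cases d (yes e≡) with same-edge p d e≡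
      ... | inj₁ refl = raised
      ... | inj₂ refl = subst₂ Change
        (sym (edge-antisym d))
        (trans (ℤ.neg-distrib-+ (flow (rev d)) _) (sym (cong₂ _+_ (antisym d) (unitFlow-antisym (rev d) d))))
        (change-neg raised)

module _ {G : Graph} {ℰ : PlanarEmbedding G} (R : OrthogonalRepresentation ℰ)
         (d₀ : Dart (Graph.numEdges G)) (many : + 4 ≤ OrthogonalRepresentation.rotE R d₀)
         {xs : List (PlanarEmbedding.Face ℰ)} (φ : Flow R d₀ xs (PlanarEmbedding.face ℰ (rev d₀))) where
  open Graph G
  open PlanarEmbedding ℰ
  open OrthogonalRepresentation R
  open Flow φ

  -- The path ends at the face left of `d₀`; stepping back through `d₀` closes it to a cycle in the
  -- dual graph, so no face sum changes.
  circulation : Dart numEdges → ℤ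
  circulation d = flow d - unitFlow d₀ d

  rerotated : Dart numEdges → ℤ
  rerotated d = rotE d + circulation d

  circulation-conserved : ∀ a → sumOver (dartsOn a) circulation ≡ 0ℤ
  circulation-conserved a = trans (sumOver-- (dartsOn a) flow (unitFlow d₀))
    (ℤ.i≡j⇒i-j≡0 (trans (conserved a) (sym (unitFlow-divergence R d₀ d₀ a))))

  rerotated-antisym : ∀ d → rerotated d ≡ - rerotated (rev d)
  rerotated-antisym d = trans
    (cong₂ _+_ (edge-antisym d) (cong₂ _-_ (antisym d) (unitFlow-antisym d₀ d)))
    (collect (rotE (rev d)) (flow (rev d)) (unitFlow d₀ (rev d)))
    where
    collect : ∀ r f u → - r + (- f - - u) ≡ - (r + (f - u))
    collect = solve-∀

  same-faceRotation : ∀ a → sumOver (dartsOn a) rerotated + sumOver (dartsOn a) rotV ≡ faceRotation a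
  same-faceRotation a = cong (_+ sumOver (dartsOn a) rotV)
    (trans (sumOver-+ (dartsOn a) rotE circulation)
           (trans (cong (_+_ (sumOver (dartsOn a) rotE)) (circulation-conserved a))
                  (ℤ.+-identityʳ (sumOver (dartsOn a) rotE))))

  rerouted : OrthogonalRepresentation ℰ
  rerouted = record
    { rotE         = rerotated
    ; rotV         = rotV
    ; rotV-values  = rotV-values
    ; edge-antisym = rerotated-antisym
    ; inner-face   = λ f f≢o → trans (same-faceRotation f) (inner-face f f≢o)
    ; outer-face   = trans (same-faceRotation outerFace) outer-face
    ; vertex-sum   = vertex-sum
    }

  ∣-∣-edge : ∀ (w : Dart numEdges → ℤ) → (∀ d → w d ≡ - w (rev d)) → ∀ d → ∣ w d ∣ ≡ ∣ w (edgeOf d , true) ∣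
  ∣-∣-edge w anti (e , true)  = refl
  ∣-∣-edge w anti (e , false) = trans (cong ∣_∣ (anti (e , false))) (ℤ.∣-i∣≡∣i∣ (w (e , true)))

  fewer-bends₀ : OrthogonalRepresentation.bends rerouted (edgeOf d₀) ℕ.< bends (edgeOf d₀)
  fewer-bends₀ = subst₂ ℕ._<_ (∣-∣-edge rerotated rerotated-antisym d₀) (∣-∣-edge rotE edge-antisym d₀)
    (subst (λ u → ∣ rotE d₀ + (flow d₀ - u) ∣ ℕ.< ∣ rotE d₀ ∣) (sym (unitFlow-self d₀))
           (lowered-bends many (admissible d₀)))

  rerouted-bends : ∀ e → OrthogonalRepresentation.bends rerouted e ℕ.≤ bends e
                         ⊎ OrthogonalRepresentation.bends rerouted e ℕ.≤ 1
  rerouted-bends e = by-cases (edgeOf d₀ Fin.≟ e)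
    where
    d = e , true
    by-cases : Dec (edgeOf d₀ ≡ e) → OrthogonalRepresentation.bends rerouted e ℕ.≤ bends e
                                     ⊎ OrthogonalRepresentation.bends rerouted e ℕ.≤ 1
    by-cases (yes refl) = inj₁ (ℕ.<⇒≤ fewer-bends₀)
    by-cases (no e₀≢e) = subst (λ δ → ∣ rotE d + δ ∣ ℕ.≤ bends e ⊎ ∣ rotE d + δ ∣ ℕ.≤ 1)
      (sym (trans (cong (λ u → flow d - u) (unitFlow-other d₀ d e₀≢e)) (ℤ.+-identityʳ (flow d))))
      (change-bends (admissible d))

  rerouted-valid : (flex : Flexibility G) → PositiveFlexibility G flex → Valid flex R → Valid flex rerouted
  rerouted-valid flex pos valid e =
    [ (λ le → ≤⁺-trans ℕ.≤-trans [ le ] (valid e)) , (λ le → ≤⁺-trans ℕ.≤-trans [ le ] (pos e)) ]′ (rerouted-bends e)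

-- Descent on the excess bends and the representations where it stops

sum-mono-< : {A : Set} {f g : A → ℕ} {x : A} (xs : List A) → (∀ y → f y ℕ.≤ g y) →
             x ∈ xs → f x ℕ.< g x → sum (map f xs) ℕ.< sum (map g xs)
sum-mono-< {f = f} {g} (y ∷ xs) le (here refl) lt = ℕ.+-mono-<-≤ lt (sum-mono-≤ xs)
  where
  sum-mono-≤ : ∀ ys → sum (map f ys) ℕ.≤ sum (map g ys)
  sum-mono-≤ []       = z≤n
  sum-mono-≤ (y ∷ ys) = ℕ.+-mono-≤ (le y) (sum-mono-≤ ys)
sum-mono-< (y ∷ xs) le (there x∈) lt = ℕ.+-mono-≤-< (le y) (sum-mono-< xs le x∈ lt)

module _ {G : Graph} {ℰ : PlanarEmbedding G} where
  open Graph G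
  open PlanarEmbedding ℰ
  open OrthogonalRepresentation

  -- The first bend of each edge is free, since rerouting may give a bend to edges that had none.
  excessBends : OrthogonalRepresentation ℰ → ℕ
  excessBends R = sum (map (λ e → bends R e ℕ.∸ 1) (allFin numEdges))

  excessBends-rerouted : (R : OrthogonalRepresentation ℰ) (d₀ : Dart numEdges) (many : + 4 ≤ rotE R d₀)
                         {xs : List Face} (φ : Flow R d₀ xs (face (rev d₀))) →
                         excessBends (rerouted R d₀ many φ) ℕ.< excessBends R
  excessBends-rerouted R d₀ many φ = sum-mono-< (allFin numEdges) le (∈-allFin (edgeOf d₀)) lt
    where
    R′ = rerouted R d₀ many φ
    le : ∀ e → bends R′ e ℕ.∸ 1 ℕ.≤ bends R e ℕ.∸ 1
    le e = [ ℕ.∸-monoˡ-≤ 1 , (λ b≤1 → subst (ℕ._≤ bends R e ℕ.∸ 1) (sym (ℕ.m≤n⇒m∸n≡0 b≤1)) z≤n) ]′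
           (rerouted-bends R d₀ many φ e)
    pred-< : ∀ {m n} → 4 ℕ.≤ n → m ℕ.< n → m ℕ.∸ 1 ℕ.< n ℕ.∸ 1
    pred-< {zero}  (s≤s (s≤s _)) _         = s≤s z≤n
    pred-< {suc m} _             (s≤s m<n) = m<n
    4≤bends : 4 ℕ.≤ bends R (edgeOf d₀)
    4≤bends = subst (4 ℕ.≤_) (∣-∣-edge R d₀ many φ (rotE R) (edge-antisym R) d₀) (lemma many)
      where
      lemma : ∀ {r} → + 4 ≤ r → 4 ℕ.≤ ∣ r ∣
      lemma (ℤ.+≤+ le) = le
    lt : bends R′ (edgeOf d₀) ℕ.∸ 1 ℕ.< bends R (edgeOf d₀) ℕ.∸ 1
    lt = pred-< 4≤bends (fewer-bends₀ R d₀ many φ)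

  bends-≤ : (R : OrthogonalRepresentation ℰ) {n : ℕ} (e : Edge) → (∀ b → rotE R (e , b) ≤ + n) → bends R e ℕ.≤ n
  bends-≤ R {n} e bound = ∣∣-bound (rotE R (e , true)) (bound true)
    (subst (_≤ + n) (edge-antisym R (e , false)) (bound false))
    where
    ∣∣-bound : ∀ i → i ≤ + n → - i ≤ + n → ∣ i ∣ ℕ.≤ n
    ∣∣-bound (+ _)      (ℤ.+≤+ le) _          = le
    ∣∣-bound (-[1+ _ ]) _          (ℤ.+≤+ le) = le

  ≮4⇒≤3 : ∀ {i} → ¬ + 4 ≤ i → i ≤ + 3
  ≮4⇒≤3 i≱4 = ℤ.i<j⇒i≤pred[j] (ℤ.≰⇒> i≱4)

  exitRegion : (R : OrthogonalRepresentation ℰ) (d : Dart numEdges) →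
               ClosedTree {end = face} {P = Raisable R d} {r = face d}
  exitRegion R d = search (λ d′ → rotE R d′ ℤ.≤? 0ℤ)

  Improvable : OrthogonalRepresentation ℰ → Dart numEdges → Set
  Improvable R d = + 4 ≤ rotE R d × face (rev d) ∈ ClosedTree.nodes (exitRegion R d)

  improvable? : (R : OrthogonalRepresentation ℰ) (d : Dart numEdges) → Dec (Improvable R d)
  improvable? R d = (+ 4 ℤ.≤? rotE R d) ×-dec (face (rev d) ∈? ClosedTree.nodes (exitRegion R d))

  module _ (biconnected : Biconnected G) (R : OrthogonalRepresentation ℰ)
           (stuck : ∀ d → ¬ Improvable R d) where

    private
      module _ (d : Dart numEdges) where
        open ClosedTree (exitRegion R d) public

      exits : ∀ d → + 4 ≤ rotE R d → face (rev d) ∉ nodes d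
      exits d many g∈ = stuck d (many , g∈)

    bend-excess-exits : ∀ d → + 4 ≤ rotE R d → face (rev d) ≡ outerFace
    bend-excess-exits d many =
      outside-outer biconnected R d many (tree d) (closed d) (exits d many) (face (rev d)) (exits d many)

    -- Both darts have the outer face on their left. The right face of `d′` is an inner one and
    -- hence lies in the region of `d`, so `d′` is another exit of that region and has rotation at
    -- most 2.
    bend-excess-unique : ∀ d d′ → + 4 ≤ rotE R d → + 4 ≤ rotE R d′ → d ≡ d′
    bend-excess-unique d d′ many many′ with d ≟ᵈ d′
    ... | yes d≡d′ = d≡d′
    ... | no  d≢d′ = contradiction
      (ℤ.≤-trans many′
        (other-exit-rotation biconnected R d many (tree d) (closed d) (exits d many) d′ inside outside d≢d′))
      λ { (ℤ.+≤+ (s≤s (s≤s ()))) }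
      where
      outside : face (rev d′) ∉ nodes d
      outside f∈ = outer∉ biconnected R d many (tree d) (closed d) (exits d many)
        (subst (_∈ nodes d) (bend-excess-exits d′ many′) f∈)
      inner : face d′ ≢ outerFace
      inner eq = outer∉ biconnected R d′ many′ (tree d′) (closed d′) (exits d′ many′)
        (subst (_∈ nodes d′) eq (root∈tree (tree d′)))
      inside : face d′ ∈ nodes d
      inside with face d′ ∈? nodes d
      ... | yes f∈ = f∈
      ... | no  f∉ = contradiction
        (outside-outer biconnected R d many (tree d) (closed d) (exits d many) (face d′) f∉) inner

    stuck-bends : AtMostThreeBendsExceptOne R
    stuck-bends with any-dart? (λ d → + 4 ℤ.≤? rotE R d)
    ... | no none = inj₁ λ e → bends-≤ R e λ b → ≮4⇒≤3 (λ many → none ((e , b) , many))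
    -- The outer face lies to the left of `d₀`, hence the witness `not b₀`.
    ... | yes (d₀@(e₀ , b₀) , many) = inj₂ (e₀ , (not b₀ , bend-excess-exits d₀ many) , at-most-five , at-most-three)
      where
      at-most-five : bends R e₀ ℕ.≤ 5
      at-most-five = bends-≤ R e₀ bound
        where
        bound : ∀ b → rotE R (e₀ , b) ≤ + 5
        bound b with + 4 ℤ.≤? rotE R (e₀ , b)
        ... | yes many′ = exit-rotation biconnected R (e₀ , b) many′ (tree _) (closed _) (exits _ many′)
        ... | no  few   = ℤ.≤-trans (≮4⇒≤3 few) (ℤ.+≤+ (s≤s (s≤s (s≤s z≤n))))
      at-most-three : ∀ e → e ≢ e₀ → bends R e ℕ.≤ 3
      at-most-three e e≢e₀ = bends-≤ R e λ b → ≮4⇒≤3 λ many′ →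
        e≢e₀ (cong edgeOf (bend-excess-unique (e , b) d₀ many′ many))

theorem2 : (G : Graph) → Biconnected G → MaxDegree≤ 4 G →
    (flex : Flexibility G) → PositiveFlexibility G flex →
    (ℰ : PlanarEmbedding G) (R : OrthogonalRepresentation ℰ) → Valid flex R →
    Σ[ R′ ∈ OrthogonalRepresentation ℰ ]
    (Valid flex R′ × SameAngles R R′ × AtMostThreeBendsExceptOne R′)
theorem2 G biconnected _ flex pos ℰ R valid = improve R valid (<-wellFounded (excessBends R))
  where
  open PlanarEmbedding ℰ
  improve : ∀ R → Valid flex R → Acc ℕ._<_ (excessBends R) →
            Σ[ R′ ∈ OrthogonalRepresentation ℰ ]
            (Valid flex R′ × SameAngles R R′ × AtMostThreeBendsExceptOne R′)
  -- A representation without an improvable dart has the required bends already; otherwise rerouting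
  -- keeps the angles and lowers `excessBends`.
  improve R valid (acc rs) with any-dart? (improvable? R)
  ... | no stuck = R , valid , (λ _ → refl) , stuck-bends biconnected R (λ d i → stuck (d , i))
  ... | yes (d₀ , many , g∈) =
    improve (rerouted R d₀ many φ) (rerouted-valid R d₀ many φ flex pos valid) (rs (excessBends-rerouted R d₀ many φ))
    where φ = push R d₀ (ClosedTree.tree (exitRegion R d₀)) g∈
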